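{- Fix an integer $m\geq3$. Then the number $p_{m,n}$ of inequivalent integer $m$-gons with perimeter $n$ satisfies \[p_{m,n}\sim \frac{2^{m-1}-m}{2^m\, m!}\,n^{m-1}\qquad\text{as } n\to\infty.\]
   Context: An integer $m$-gon is a polygon with $m$ sides whose side lengths are all positive integers; its perimeter is the sum of the side lengths. Reading the side lengths starting from any side, clockwise or anticlockwise, gives an $m$-tuple; two $m$-gons are equivalent if the $m$-tuple of one can be obtained from that of the other by cyclically re-ordering and/or reversing the entries. (Side-length tuples of integer $m$-gons of perimeter $n$ are exactly $m$-tuples of positive integers summing to $n$ with every entry less than $n/2$.) $f\sim g$ means $f/g\to1$. -}

module Defs where

open import Data.Bool using (Bool; true; false; _∧_; _∨_)
open import Data.Nat using (ℕ; zero; suc; _+_; _*_; _∸_; _^_; _≤_; _<ᵇ_; _≡ᵇ_; _!)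
open import Data.Nat.Properties using (m*n≢0; m^n≢0; _!≢0)
open import Data.List using (List; []; _∷_; _++_; map; concatMap; filterᵇ; length; take; drop; reverse; upTo; sum)
open import Data.Bool.ListAction using (and)
open import Data.Integer using (ℤ; +_)
open import Data.Rational using (ℚ; _/_)

compositions : ℕ → ℕ → List (List ℕ)
compositions zero    zero    = [] ∷ []
compositions zero    (suc n) = []
compositions (suc k) n       =
  concatMap (λ i → map (suc i ∷_) (compositions k (n ∸ suc i))) (upTo n)

-- Side-length tuples of integer m-gons of perimeter n:
-- m-tuples of positive integers summing to n, every entry < n/2 (i.e. 2a < n).
polygonTuples : ℕ → ℕ → List (List ℕ)
polygonTuples m n = filterᵇ (λ xs → and (map (λ a → (2 * a) <ᵇ n) xs)) (compositions m n)

rotate : ℕ → List ℕ → List ℕ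
rotate i xs = drop i xs ++ take i xs

dihedralImages : List ℕ → List (List ℕ)
dihedralImages xs =
  map (λ i → rotate i xs) (upTo (length xs)) ++
  map (λ i → reverse (rotate i xs)) (upTo (length xs))

lexLeq : List ℕ → List ℕ → Bool
lexLeq []       _        = true
lexLeq (_ ∷ _)  []       = false
lexLeq (x ∷ xs) (y ∷ ys) = (x <ᵇ y) ∨ ((x ≡ᵇ y) ∧ lexLeq xs ys)

isCanonical : List ℕ → Bool
isCanonical xs = and (map (lexLeq xs) (dihedralImages xs))

-- p_{m,n}: number of inequivalent integer m-gons of perimeter n
-- (= number of equivalence classes = number of canonical representatives)
p : ℕ → ℕ → ℕ
p m n = length (filterᵇ isCanonical (polygonTuples m n))

constant : ℕ → ℚ
constant m = _/_ (+ (2 ^ (m ∸ 1) ∸ m)) (2 ^ m * m !)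
  {{m*n≢0 (2 ^ m) (m !) {{m^n≢0 2 m}} {{m !≢0}}}}

ℕtoℚ : ℕ → ℚ
ℕtoℚ k = (+ k) / 1

{-# OPTIONS --safe #-}
-- The dihedral group of order 2m acts on the compositions of n into m parts, so 2m·p counts each polygon
-- tuple with the number of its canonical images. That number is 1 for a tuple with distinct entries, and
-- at most 2m otherwise; a repeated entry can be rotated to the front, so only O(n^(m-2)) compositions have one.
-- By rotation again, and since at most one entry can be ≥ n/2, the polygon tuples are counted by C(n-1, m-1)
-- minus m times the number C(⌈(n-1)/2⌉, m-1) of compositions whose first entry is too long.
-- These give |2^m m! p - (2^(m-1) - m) n^(m-1)| ≤ K n^(m-2), which is proved in ℕ with both sides
-- arranged so that no subtraction occurs.
module Submission where

open import Defs
open import Data.Bool using (Bool; true; false; not; T)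
open import Data.Nat using (ℕ; zero; suc; _+_; _*_; _∸_; _^_; _≤_; _<_; z≤n; s≤s; z<s; _<ᵇ_; _≡ᵇ_; _<?_; ⌊_/2⌋; ⌈_/2⌉; _!; _≥_; NonZero)
open import Data.Nat.Properties
open import Data.Nat.ListAction using (sum)
open import Data.Nat.ListAction.Properties using (sum-++; sum-↭)
open import Data.List using (List; []; _∷_; _++_; map; concatMap; filterᵇ; length; take; drop; reverse; upTo)
open import Data.List.Properties using (map-∘; map-++; map-upTo; ∷-injectiveʳ; ∷-injectiveˡ; ++-assoc; ++-identityʳ; length-++; take++drop≡id; length-drop; take-all; drop-all; reverse-++; unfold-reverse; reverse-involutive; reverse-injective; length-upTo; length-map)
open import Data.List.Membership.Propositional using (_∈_)
open import Data.List.Membership.Propositional.Properties using (∈-map⁺; ∈-map⁻; ∈-upTo⁺; ∈-upTo⁻; ∈-concatMap⁺; ∈-concatMap⁻; ∈-++⁺ˡ; ∈-++⁺ʳ; ∈-++⁻)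
open import Data.List.Relation.Unary.Any as Any using (Any; here; there)
open import Data.List.Relation.Unary.All as All using (All; []; _∷_)
open import Data.List.Relation.Unary.AllPairs as AllPairs using ([]; _∷_)
import Data.List.Relation.Unary.AllPairs.Properties as AllPairs
import Data.List.Relation.Unary.All.Properties as All
import Data.List.Relation.Unary.Unique.Propositional.Properties as Unique
open import Data.List.Relation.Unary.Unique.Propositional using (Unique)
open import Data.List.Relation.Binary.Permutation.Propositional using (_↭_; ↭-sym; ↭-trans; ↭-reflexive; ↭⇒↭ₛ)
open import Data.List.Relation.Binary.Permutation.Propositional.Properties using (All-resp-↭; ↭-length; map⁺; ++-comm; ↭-reverse)
open import Data.List.Membership.Propositional.Properties.WithK using (unique∧set⇒bag)
open import Data.List.Relation.Binary.BagAndSetEquality using (∼bag⇒↭)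
open import Data.Product using (∃; _×_; _,_; proj₁; ∃₂)
open import Function using (_∘_; mk⇔; Equivalence)
open import Relation.Binary.PropositionalEquality
open import Data.Bool.Properties using (T-∨; T-∧)
import Data.List.Relation.Binary.Permutation.Setoid.Properties as PermSetoid
open import Data.Empty using (⊥; ⊥-elim)
open import Data.Sum using (_⊎_; inj₁; inj₂)
open import Relation.Nullary using (yes; no)
open import Relation.Binary.Definitions using (tri<; tri≈; tri>)
open import Data.Bool.ListAction using (and)
open import Data.Nat.Solver using (module +-*-Solver)
open import Data.Integer as ℤ using (+[1+_])
import Data.Integer.Properties as ℤ
open import Data.Rational as ℚ using (ℚ; mkℚ; 0ℚ; ∣_∣)
import Data.Rational.Properties as ℚ
open import Data.Rational.Solver as ℚ-Solver using ()
open import Data.Rational.Unnormalised as ℚᵘ using (mkℚᵘ; *≡*; *<*)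
import Data.Rational.Unnormalised.Properties as ℚᵘ

-- No group is formed: the 2m rotations and reflections are only a list of images, with repetitions.
-- Each of these maps permutes the compositions, so summing the indicator of canonical polygon
-- tuples over all images multiplies its total by exactly 2m, and no orbit sizes are needed. All
-- that must be known about a single tuple is that it has at least one canonical image, and at most
-- 1 + 2m r of them, where r counts coincidences of entries over all rotations. Both bounds are
-- linear, so they can be summed. The constant appears after multiplying by U = 2^d d!, where d = m
-- - 1: up to O(n^(d-1)), U C(n-1, d) is 2^d n^d and U C(⌈(n-1)/2⌉, d) is n^d, hence the coefficient
-- 2^d - m. The factor 2m then turns U into 2^m m!. This coefficient is positive for m ≥ 3, so an
-- error of order n^(d-1) eventually falls below any positive multiple of the main term.

private
  variable
    A B : Set

-- Finite sums over lists, and indicators.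

∑ : List A → (A → ℕ) → ℕ
∑ xs f = sum (map f xs)

∑-cong : ∀ (xs : List A) {f g : A → ℕ} → (∀ {x} → x ∈ xs → f x ≡ g x) → ∑ xs f ≡ ∑ xs g
∑-cong []       f≗g = refl
∑-cong (x ∷ xs) f≗g = cong₂ _+_ (f≗g (here refl)) (∑-cong xs (f≗g ∘ there))

∑-mono : ∀ (xs : List A) {f g : A → ℕ} → (∀ {x} → x ∈ xs → f x ≤ g x) → ∑ xs f ≤ ∑ xs g
∑-mono []       f≤g = z≤n
∑-mono (x ∷ xs) f≤g = +-mono-≤ (f≤g (here refl)) (∑-mono xs (f≤g ∘ there))

∑-const : ∀ (xs : List A) c → ∑ xs (λ _ → c) ≡ length xs * c
∑-const []       c = refl
∑-const (x ∷ xs) c = cong (c +_) (∑-const xs c)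

∑-zero : ∀ (xs : List A) → ∑ xs (λ _ → 0) ≡ 0
∑-zero xs = trans (∑-const xs 0) (*-zeroʳ (length xs))

∑-distrib-+ : ∀ (xs : List A) (f g : A → ℕ) → ∑ xs (λ x → f x + g x) ≡ ∑ xs f + ∑ xs g
∑-distrib-+ []       f g = refl
∑-distrib-+ (x ∷ xs) f g = begin
  f x + g x + ∑ xs (λ x → f x + g x) ≡⟨ cong (f x + g x +_) (∑-distrib-+ xs f g) ⟩
  f x + g x + (∑ xs f + ∑ xs g)      ≡⟨ +-assoc (f x) (g x) _ ⟩
  f x + (g x + (∑ xs f + ∑ xs g))    ≡⟨ cong (f x +_) (sym (+-assoc (g x) (∑ xs f) _)) ⟩
  f x + (g x + ∑ xs f + ∑ xs g)      ≡⟨ cong (λ z → f x + (z + ∑ xs g)) (+-comm (g x) _) ⟩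
  f x + (∑ xs f + g x + ∑ xs g)      ≡⟨ cong (f x +_) (+-assoc (∑ xs f) _ _) ⟩
  f x + (∑ xs f + (g x + ∑ xs g))    ≡⟨ sym (+-assoc (f x) _ _) ⟩
  f x + ∑ xs f + (g x + ∑ xs g)      ∎
  where open ≡-Reasoning

∑-distribˡ-* : ∀ (xs : List A) c (f : A → ℕ) → ∑ xs (λ x → c * f x) ≡ c * ∑ xs f
∑-distribˡ-* []       c f = sym (*-zeroʳ c)
∑-distribˡ-* (x ∷ xs) c f = trans (cong (c * f x +_) (∑-distribˡ-* xs c f)) (sym (*-distribˡ-+ c (f x) _))

∑-swap : ∀ (xs : List A) (ys : List B) (f : A → B → ℕ) →
         ∑ xs (λ x → ∑ ys (f x)) ≡ ∑ ys (λ y → ∑ xs (λ x → f x y))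
∑-swap []       ys f = sym (∑-zero ys)
∑-swap (x ∷ xs) ys f = trans (cong (∑ ys (f x) +_) (∑-swap xs ys f))
                             (sym (∑-distrib-+ ys (f x) (λ y → ∑ xs (λ x → f x y))))

∑-map : ∀ (g : A → B) xs (f : B → ℕ) → ∑ (map g xs) f ≡ ∑ xs (f ∘ g)
∑-map g xs f = cong sum (sym (map-∘ xs))

∑-++ : ∀ (xs ys : List A) (f : A → ℕ) → ∑ (xs ++ ys) f ≡ ∑ xs f + ∑ ys f
∑-++ xs ys f = trans (cong sum (map-++ f xs ys)) (sum-++ (map f xs) (map f ys))

∑-concatMap : ∀ (g : A → List B) xs (f : B → ℕ) → ∑ (concatMap g xs) f ≡ ∑ xs (λ x → ∑ (g x) f)
∑-concatMap g []       f = refl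
∑-concatMap g (x ∷ xs) f = trans (∑-++ (g x) (concatMap g xs) f) (cong (∑ (g x) f +_) (∑-concatMap g xs f))

∑-↭ : ∀ {xs ys : List A} (f : A → ℕ) → xs ↭ ys → ∑ xs f ≡ ∑ ys f
∑-↭ f xs↭ys = sum-↭ (map⁺ f xs↭ys)

∑-∈-≤ : ∀ {xs : List A} (f : A → ℕ) {x} → x ∈ xs → f x ≤ ∑ xs f
∑-∈-≤ f (here refl)  = m≤m+n _ _
∑-∈-≤ f (there {x} x∈xs) = ≤-trans (∑-∈-≤ f x∈xs) (m≤n+m _ (f x))

∑-upTo-suc : ∀ n (f : ℕ → ℕ) → ∑ (upTo (suc n)) f ≡ f 0 + ∑ (upTo n) (f ∘ suc)
∑-upTo-suc n f = cong (λ is → f 0 + sum is)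
  (trans (cong (map f) (sym (map-upTo suc n))) (sym (map-∘ (upTo n))))

𝟙 : Bool → ℕ
𝟙 true  = 1
𝟙 false = 0

length-filterᵇ : ∀ (P : A → Bool) xs → length (filterᵇ P xs) ≡ ∑ xs (𝟙 ∘ P)
length-filterᵇ P []       = refl
length-filterᵇ P (x ∷ xs) with P x
... | true  = cong suc (length-filterᵇ P xs)
... | false = length-filterᵇ P xs

∑-filterᵇ : ∀ (P : A → Bool) xs (f : A → ℕ) → ∑ (filterᵇ P xs) f ≡ ∑ xs (λ x → 𝟙 (P x) * f x)
∑-filterᵇ P []       f = refl
∑-filterᵇ P (x ∷ xs) f with P x
... | true  = cong₂ _+_ (sym (*-identityˡ (f x))) (∑-filterᵇ P xs f)
... | false = ∑-filterᵇ P xs f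

-- Compositions as a duplicate-free list, and bijections of it.

IsComposition : ℕ → ℕ → List ℕ → Set
IsComposition m n xs = length xs ≡ m × sum xs ≡ n × All (0 <_) xs

∈-compositions⁻ : ∀ m n {xs} → xs ∈ compositions m n → IsComposition m n xs
∈-compositions⁻ zero    zero    (here refl) = refl , refl , []
∈-compositions⁻ (suc m) n {xs} xs∈ = go (upTo n) (∈-upTo⁻ {n}) (∈-concatMap⁻ _ {xs = upTo n} xs∈)
  where
  -- The bound i < n, carried along the list, makes the truncated `n ∸ suc i` a true difference.
  go : ∀ is → (∀ {i} → i ∈ is → i < n) →
       Any (λ i → xs ∈ map (suc i ∷_) (compositions m (n ∸ suc i))) is → IsComposition (suc m) n xs
  go (i ∷ is) bd (there any) = go is (bd ∘ there) any
  go (i ∷ is) bd (here px) with ∈-map⁻ (suc i ∷_) px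
  ... | ys , ys∈ , refl with ∈-compositions⁻ m (n ∸ suc i) ys∈
  ... | len , sm , pos = cong suc len , trans (cong (suc i +_) sm) (m+[n∸m]≡n (bd (here refl))) , z<s ∷ pos

∈-compositions⁺ : ∀ m n {xs} → IsComposition m n xs → xs ∈ compositions m n
∈-compositions⁺ zero    .0 {[]} (refl , refl , [])  = here refl
∈-compositions⁺ (suc m) .(suc x + sum xs) {suc x ∷ xs} (len , refl , _ ∷ pos) =
  ∈-concatMap⁺ _ (Any.map (λ {refl → ∈-map⁺ (suc x ∷_) tail∈}) (∈-upTo⁺ {suc x + sum xs} {x} (s≤s (m≤m+n x (sum xs)))))
  where
  tail∈ : xs ∈ compositions m (suc x + sum xs ∸ suc x)
  tail∈ = subst (λ n → xs ∈ compositions m n) (sym (m+n∸m≡n x (sum xs)))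
                (∈-compositions⁺ m (sum xs) (suc-injective len , refl , pos))

compositions-unique : ∀ m n → Unique (compositions m n)
compositions-unique zero    zero    = [] ∷ []
compositions-unique zero    (suc n) = []
compositions-unique (suc m) n = Unique.concat⁺
  (All.map⁺ (All.universal (λ i → Unique.map⁺ ∷-injectiveʳ (compositions-unique m (n ∸ suc i))) (upTo n)))
  (AllPairs.map⁺ (AllPairs.map disjoint (Unique.upTo⁺ n)))
  where
  disjoint : ∀ {i j} → i ≢ j → ∀ {xs} →
    (xs ∈ map (suc i ∷_) (compositions m (n ∸ suc i))) × (xs ∈ map (suc j ∷_) (compositions m (n ∸ suc j))) → _
  disjoint i≢j (∈i , ∈j) with ∈-map⁻ _ ∈i | ∈-map⁻ _ ∈j
  ... | _ , _ , refl | _ , _ , eq = i≢j (suc-injective (∷-injectiveˡ eq))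

∈-compositions-resp-↭ : ∀ m n {xs ys} → xs ↭ ys → xs ∈ compositions m n → ys ∈ compositions m n
∈-compositions-resp-↭ m n xs↭ys xs∈ with ∈-compositions⁻ m n xs∈
... | len , sm , pos = ∈-compositions⁺ m n
  (trans (↭-length (↭-sym xs↭ys)) len , trans (sum-↭ (↭-sym xs↭ys)) sm , All-resp-↭ xs↭ys pos)

-- The image of the list of compositions under `g` has no duplicates and the same members, so it is
-- a permutation of that list. The inverse laws are restricted to length m because `rotate (m ∸ i)`
-- undoes `rotate i` only there.
∑-compositions-invariant : ∀ m n (g g⁻¹ : List ℕ → List ℕ) →
  (∀ xs → g xs ↭ xs) → (∀ xs → g⁻¹ xs ↭ xs) →
  (∀ xs → length xs ≡ m → g⁻¹ (g xs) ≡ xs) → (∀ xs → length xs ≡ m → g (g⁻¹ xs) ≡ xs) →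
  ∀ f → ∑ (compositions m n) (f ∘ g) ≡ ∑ (compositions m n) f
∑-compositions-invariant m n g g⁻¹ g↭ g⁻¹↭ g⁻¹g gg⁻¹ f =
  trans (sym (∑-map g C f)) (∑-↭ f (∼bag⇒↭ (unique∧set⇒bag (unique-map g-inj C!) C! (mk⇔ to from))))
  where
  C = compositions m n
  C! = compositions-unique m n

  len : ∀ {xs} → xs ∈ C → length xs ≡ m
  len = proj₁ ∘ ∈-compositions⁻ m n

  g-inj : ∀ {xs ys} → xs ∈ C → ys ∈ C → g xs ≡ g ys → xs ≡ ys
  g-inj xs∈ ys∈ eq = trans (sym (g⁻¹g _ (len xs∈))) (trans (cong g⁻¹ eq) (g⁻¹g _ (len ys∈)))

  unique-map : ∀ {L} → (∀ {xs ys} → xs ∈ L → ys ∈ L → g xs ≡ g ys → xs ≡ ys) → Unique L → Unique (map g L)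
  unique-map inj []       = []
  unique-map inj (x∉ ∷ u) =
    All.map⁺ (All.tabulate (λ y∈ eq → All.lookup x∉ y∈ (inj (here refl) (there y∈) eq)))
    ∷ unique-map (λ p q → inj (there p) (there q)) u

  to : ∀ {xs} → xs ∈ map g C → xs ∈ C
  to xs∈ with ∈-map⁻ g xs∈
  ... | ys , ys∈ , refl = ∈-compositions-resp-↭ m n (↭-sym (g↭ ys)) ys∈

  from : ∀ {xs} → xs ∈ C → xs ∈ map g C
  from {xs} xs∈ = subst (_∈ map g C) (gg⁻¹ xs (len xs∈))
    (∈-map⁺ g (∈-compositions-resp-↭ m n (↭-sym (g⁻¹↭ xs)) xs∈))

-- Rotations and reversal of lists.

rotate-++ : ∀ ps ss → rotate (length ps) (ps ++ ss) ≡ ss ++ ps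
rotate-++ ps ss = cong₂ _++_ (drop-length ps) (take-length ps)
  where
  drop-length : ∀ ps → drop (length ps) (ps ++ ss) ≡ ss
  drop-length []       = refl
  drop-length (p ∷ ps) = drop-length ps

  take-length : ∀ ps → take (length ps) (ps ++ ss) ≡ ps
  take-length []       = refl
  take-length (p ∷ ps) = cong (p ∷_) (take-length ps)

split-at : ∀ i (xs : List A) → i < length xs →
           ∃₂ λ ps x → ∃ λ ss → xs ≡ ps ++ x ∷ ss × length ps ≡ i
split-at zero    (x ∷ xs) _         = [] , x , xs , refl , refl
split-at (suc i) (x ∷ xs) (s≤s i<n) with split-at i xs i<n
... | ps , y , ss , eq , len = x ∷ ps , y , ss , cong (x ∷_) eq , cong suc len

-- The bound matters: past the length, `drop` and `take` saturate, so `rotate` becomes the identity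
-- instead of continuing cyclically.
rotate-suc : ∀ i xs → i < length xs → rotate (suc i) xs ≡ rotate 1 (rotate i xs)
rotate-suc i xs i<n with split-at i xs i<n
... | ps , x , ss , refl , refl = begin
  rotate (suc (length ps)) (ps ++ x ∷ ss)               ≡⟨ cong₂ rotate len (sym (++-assoc ps (x ∷ []) ss)) ⟩
  rotate (length (ps ++ x ∷ [])) ((ps ++ x ∷ []) ++ ss) ≡⟨ rotate-++ (ps ++ x ∷ []) ss ⟩
  ss ++ (ps ++ x ∷ [])                                  ≡⟨ sym (++-assoc ss ps (x ∷ [])) ⟩
  rotate 1 (x ∷ ss ++ ps)                               ≡⟨ cong (rotate 1) (sym (rotate-++ ps (x ∷ ss))) ⟩
  rotate 1 (rotate (length ps) (ps ++ x ∷ ss))          ∎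
  where
  open ≡-Reasoning
  len : suc (length ps) ≡ length (ps ++ x ∷ [])
  len = trans (+-comm 1 (length ps)) (sym (length-++ ps))

rotate-all : ∀ i xs → length xs ≤ i → rotate i xs ≡ xs
rotate-all i xs n≤i = cong₂ _++_ (drop-all i xs n≤i) (take-all i xs n≤i)

rotate-0 : ∀ xs → rotate 0 xs ≡ xs
rotate-0 = ++-identityʳ

-- Rotation exchanges `take i xs` and `drop i xs`; the latter has length `m ∸ i`, so rotating by
-- that amount exchanges them back.
rotate-inverse : ∀ {m} i xs → length xs ≡ m → rotate (m ∸ i) (rotate i xs) ≡ xs
rotate-inverse i xs refl = begin
  rotate (length xs ∸ i) (rotate i xs)      ≡⟨ cong (λ k → rotate k (rotate i xs)) (sym (length-drop i xs)) ⟩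
  rotate (length (drop i xs)) (rotate i xs) ≡⟨ rotate-++ (drop i xs) (take i xs) ⟩
  take i xs ++ drop i xs                    ≡⟨ take++drop≡id i xs ⟩
  xs                                        ∎
  where open ≡-Reasoning

rotate-↭ : ∀ i xs → rotate i xs ↭ xs
rotate-↭ i xs = ↭-trans (++-comm (drop i xs) (take i xs)) (↭-reflexive (take++drop≡id i xs))

-- The dihedral relation r s r = s between the rotation r and the reflection s.
reverse-rotate-1 : ∀ xs → rotate 1 (reverse (rotate 1 xs)) ≡ reverse xs
reverse-rotate-1 []       = refl
reverse-rotate-1 (x ∷ xs) = trans (cong (rotate 1) (reverse-++ xs (x ∷ []))) (sym (unfold-reverse x xs))

-- Dihedral equivalence of tuples.

infix 4 _rotates-to_ _reflects-to_

_rotates-to_ : List ℕ → List ℕ → Set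
xs rotates-to ys = ∃ λ i → i < length xs × ys ≡ rotate i xs

_reflects-to_ : List ℕ → List ℕ → Set
xs reflects-to ys = ∃ λ i → i < length xs × ys ≡ reverse (rotate i xs)

∈-dihedralImages⁻ : ∀ xs {ys} → ys ∈ dihedralImages xs → xs rotates-to ys ⊎ xs reflects-to ys
∈-dihedralImages⁻ xs ys∈ with ∈-++⁻ (map (λ i → rotate i xs) (upTo (length xs))) ys∈
... | inj₁ ys∈ˡ with ∈-map⁻ _ ys∈ˡ
...   | i , i∈ , eq = inj₁ (i , ∈-upTo⁻ i∈ , eq)
∈-dihedralImages⁻ xs ys∈ | inj₂ ys∈ʳ with ∈-map⁻ _ ys∈ʳ
...   | i , i∈ , eq = inj₂ (i , ∈-upTo⁻ i∈ , eq)

∈-dihedralImages⁺ : ∀ xs {ys} → xs rotates-to ys ⊎ xs reflects-to ys → ys ∈ dihedralImages xs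
∈-dihedralImages⁺ xs (inj₁ (i , i<n , refl)) = ∈-++⁺ˡ (∈-map⁺ _ (∈-upTo⁺ i<n))
∈-dihedralImages⁺ xs (inj₂ (i , i<n , refl)) = ∈-++⁺ʳ _ (∈-map⁺ _ (∈-upTo⁺ i<n))

∈-dihedralImages⇒↭ : ∀ xs {ys} → ys ∈ dihedralImages xs → ys ↭ xs
∈-dihedralImages⇒↭ xs ys∈ with ∈-dihedralImages⁻ xs ys∈
... | inj₁ (i , _ , refl) = rotate-↭ i xs
... | inj₂ (i , _ , refl) = ↭-trans (↭-reverse (rotate i xs)) (rotate-↭ i xs)

rotates-to-rotate-1 : ∀ {xs ys} → xs rotates-to ys → xs rotates-to rotate 1 ys
rotates-to-rotate-1 {xs} (i , i<n , refl) with suc i <? length xs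
... | yes 1+i<n = suc i , 1+i<n , sym (rotate-suc i xs i<n)
-- Rotating past the last index gives back the tuple itself, which is listed under index 0.
... | no  1+i≮n = 0 , ≤-trans z<s i<n ,
  trans (sym (rotate-suc i xs i<n)) (trans (rotate-all (suc i) xs (≮⇒≥ 1+i≮n)) (sym (rotate-0 xs)))

-- By r s r = s, rotating a reflection once more lowers its index by one; index 0 wraps round to the
-- last index.
reflects-to-rotate-1 : ∀ {xs ys} → xs reflects-to ys → xs reflects-to rotate 1 ys
reflects-to-rotate-1 {xs} (suc i , 1+i<n , refl) = i , <-trans (n<1+n i) 1+i<n ,
  trans (cong (rotate 1 ∘ reverse) (rotate-suc i xs (<-trans (n<1+n i) 1+i<n))) (reverse-rotate-1 (rotate i xs))
reflects-to-rotate-1 {x ∷ xs} (zero , _ , refl) = length xs , n<1+n _ , (begin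
  rotate 1 (reverse (rotate 0 (x ∷ xs)))                 ≡⟨ cong (rotate 1 ∘ reverse) (rotate-0 (x ∷ xs)) ⟩
  rotate 1 (reverse (x ∷ xs))                            ≡⟨ cong (rotate 1 ∘ reverse) (sym full) ⟩
  rotate 1 (reverse (rotate 1 (rotate (length xs) (x ∷ xs)))) ≡⟨ reverse-rotate-1 (rotate (length xs) (x ∷ xs)) ⟩
  reverse (rotate (length xs) (x ∷ xs))                  ∎)
  where
  open ≡-Reasoning
  full : rotate 1 (rotate (length xs) (x ∷ xs)) ≡ x ∷ xs
  full = trans (sym (rotate-suc (length xs) (x ∷ xs) (n<1+n _))) (rotate-all (suc (length xs)) (x ∷ xs) ≤-refl)

-- Reduces every closure property to a single rotation step; indices beyond the length are harmless,
-- since such rotations are the identity.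
rotate-closed : ∀ {P : List ℕ → Set} → (∀ {ys} → P ys → P (rotate 1 ys)) → ∀ i {ys} → P ys → P (rotate i ys)
rotate-closed {P} closed zero    {ys} p = subst P (sym (rotate-0 ys)) p
rotate-closed {P} closed (suc i) {ys} p with i <? length ys
... | yes i<n = subst P (sym (rotate-suc i ys i<n)) (closed (rotate-closed {P} closed i p))
... | no  i≮n = subst P (sym (rotate-all (suc i) ys (m≤n⇒m≤1+n (≮⇒≥ i≮n)))) p

rotates-to-refl : ∀ {xs} → 0 < length xs → xs rotates-to xs
rotates-to-refl {xs} 0<n = 0 , 0<n , sym (rotate-0 xs)

rotates-to-trans : ∀ {xs ys zs} → xs rotates-to ys → ys rotates-to zs → xs rotates-to zs
rotates-to-trans {xs} r (i , _ , refl) = rotate-closed {xs rotates-to_} rotates-to-rotate-1 i r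

rotates-to-sym : ∀ {xs ys} → xs rotates-to ys → ys rotates-to xs
rotates-to-sym {xs} {ys} (i , i<n , eq) = subst (ys rotates-to_) back
  (rotate-closed {ys rotates-to_} rotates-to-rotate-1 (length xs ∸ i) (rotates-to-refl 0<len))
  where
  back : rotate (length xs ∸ i) ys ≡ xs
  back = trans (cong (rotate (length xs ∸ i)) eq) (rotate-inverse i xs refl)
  0<len : 0 < length ys
  0<len = subst (0 <_) (sym (trans (cong length eq) (↭-length (rotate-↭ i xs)))) (≤-trans z<s i<n)

infix 4 _~_
-- Reflexive on nonempty tuples only: the empty list has no dihedral images.
_~_ : List ℕ → List ℕ → Set
xs ~ ys = ys ∈ dihedralImages xs

~-rotate : ∀ xs {ys} i → xs ~ ys → xs ~ rotate i ys
~-rotate xs i = rotate-closed {xs ~_} step i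
  where
  step : ∀ {ys} → xs ~ ys → xs ~ rotate 1 ys
  step xs~ys with ∈-dihedralImages⁻ xs xs~ys
  ... | inj₁ r = ∈-dihedralImages⁺ xs (inj₁ (rotates-to-rotate-1 r))
  ... | inj₂ r = ∈-dihedralImages⁺ xs (inj₂ (reflects-to-rotate-1 r))

~-reverse : ∀ xs {ys} → xs ~ ys → xs ~ reverse ys
~-reverse xs xs~ys with ∈-dihedralImages⁻ xs xs~ys
... | inj₁ (i , i<n , refl) = ∈-dihedralImages⁺ xs (inj₂ (i , i<n , refl))
... | inj₂ (i , i<n , refl) = ∈-dihedralImages⁺ xs (inj₁ (i , i<n , reverse-involutive _))

~-trans : ∀ xs ys {zs} → xs ~ ys → ys ~ zs → xs ~ zs
~-trans xs ys xs~ys ys~zs with ∈-dihedralImages⁻ ys ys~zs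
... | inj₁ (i , _ , refl) = ~-rotate xs i xs~ys
... | inj₂ (i , _ , refl) = ~-reverse xs (~-rotate xs i xs~ys)

~-refl : ∀ xs → 0 < length xs → xs ~ xs
~-refl xs 0<n = ∈-dihedralImages⁺ xs (inj₁ (rotates-to-refl 0<n))

-- A reflection of `xs` is the reversal of a rotation `zs`; reversing it again gives `zs`, and
-- rotating on gives `xs`.
~-sym : ∀ xs {ys} → xs ~ ys → ys ~ xs
~-sym xs xs~ys with ∈-dihedralImages⁻ xs xs~ys
... | inj₁ r = ∈-dihedralImages⁺ _ (inj₁ (rotates-to-sym r))
... | inj₂ (i , i<n , refl) = ~-trans (reverse zs) zs
  (subst (reverse zs ~_) (reverse-involutive zs) (~-reverse (reverse zs) (~-refl (reverse zs) 0<len)))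
  (∈-dihedralImages⁺ _ (inj₁ (rotates-to-sym {xs} (i , i<n , refl))))
  where
  zs = rotate i xs
  0<len : 0 < length (reverse zs)
  0<len = subst (0 <_) (sym (↭-length (∈-dihedralImages⇒↭ xs xs~ys))) (≤-trans z<s i<n)

-- Lexicographic order and canonical representatives.

lexLeq-∷⁻ : ∀ x xs y ys → T (lexLeq (x ∷ xs) (y ∷ ys)) → x < y ⊎ (x ≡ y × T (lexLeq xs ys))
lexLeq-∷⁻ x xs y ys t with Equivalence.to T-∨ t
... | inj₁ lt = inj₁ (<ᵇ⇒< x y lt)
... | inj₂ eq∧le with Equivalence.to T-∧ eq∧le
...   | eq , le = inj₂ (≡ᵇ⇒≡ x y eq , le)

lexLeq-∷⁺ : ∀ x xs y ys → x < y ⊎ (x ≡ y × T (lexLeq xs ys)) → T (lexLeq (x ∷ xs) (y ∷ ys))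
lexLeq-∷⁺ x xs y ys (inj₁ lt)        = Equivalence.from T-∨ (inj₁ (<⇒<ᵇ lt))
lexLeq-∷⁺ x xs y ys (inj₂ (eq , le)) = Equivalence.from (T-∨ {x <ᵇ y}) (inj₂ (Equivalence.from T-∧ (≡⇒≡ᵇ x y eq , le)))

lexLeq-total : ∀ xs ys → T (lexLeq xs ys) ⊎ T (lexLeq ys xs)
lexLeq-total []       ys       = inj₁ _
lexLeq-total (x ∷ xs) []       = inj₂ _
lexLeq-total (x ∷ xs) (y ∷ ys) with <-cmp x y | lexLeq-total xs ys
... | tri< x<y _ _ | _       = inj₁ (lexLeq-∷⁺ x xs y ys (inj₁ x<y))
... | tri> _ _ y<x | _       = inj₂ (lexLeq-∷⁺ y ys x xs (inj₁ y<x))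
... | tri≈ _ x≡y _ | inj₁ le = inj₁ (lexLeq-∷⁺ x xs y ys (inj₂ (x≡y , le)))
... | tri≈ _ x≡y _ | inj₂ le = inj₂ (lexLeq-∷⁺ y ys x xs (inj₂ (sym x≡y , le)))

lexLeq-trans : ∀ xs ys zs → T (lexLeq xs ys) → T (lexLeq ys zs) → T (lexLeq xs zs)
lexLeq-trans []       ys       zs       p q = _
lexLeq-trans (x ∷ xs) (y ∷ ys) (z ∷ zs) p q with lexLeq-∷⁻ x xs y ys p | lexLeq-∷⁻ y ys z zs q
... | inj₁ x<y         | inj₁ y<z         = lexLeq-∷⁺ x xs z zs (inj₁ (<-trans x<y y<z))
... | inj₁ x<y         | inj₂ (refl , _)  = lexLeq-∷⁺ x xs z zs (inj₁ x<y)
... | inj₂ (refl , _)  | inj₁ y<z         = lexLeq-∷⁺ x xs z zs (inj₁ y<z)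
... | inj₂ (refl , p′) | inj₂ (refl , q′) = lexLeq-∷⁺ x xs z zs (inj₂ (refl , lexLeq-trans xs ys zs p′ q′))

lexLeq-antisym : ∀ xs ys → T (lexLeq xs ys) → T (lexLeq ys xs) → xs ≡ ys
lexLeq-antisym []       []       p q = refl
lexLeq-antisym (x ∷ xs) (y ∷ ys) p q with lexLeq-∷⁻ x xs y ys p | lexLeq-∷⁻ y ys x xs q
... | inj₁ x<y         | inj₁ y<x        = ⊥-elim (<-asym x<y y<x)
... | inj₁ x<y         | inj₂ (refl , _) = ⊥-elim (<-irrefl refl x<y)
... | inj₂ (refl , _)  | inj₁ y<x        = ⊥-elim (<-irrefl refl y<x)
... | inj₂ (refl , p′) | inj₂ (_ , q′)   = cong (x ∷_) (lexLeq-antisym xs ys p′ q′)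

lexLeq-refl : ∀ xs → T (lexLeq xs xs)
lexLeq-refl xs with lexLeq-total xs xs
... | inj₁ p = p
... | inj₂ p = p

lex-minimum : ∀ {xs L} → xs ∈ L → ∃ λ ys → ys ∈ L × All (T ∘ lexLeq ys) L
lex-minimum {L = zs ∷ []}      _ = zs , here refl , lexLeq-refl zs ∷ []
lex-minimum {L = zs ∷ us ∷ L} _ with lex-minimum {us} {us ∷ L} (here refl)
... | ys , ys∈ , ys≤ with lexLeq-total zs ys
...   | inj₁ zs≤ys = zs , here refl , lexLeq-refl zs ∷ All.map (λ {vs} → lexLeq-trans zs ys vs zs≤ys) ys≤
...   | inj₂ ys≤zs = ys , there ys∈ , ys≤zs ∷ ys≤

-- Images are counted with multiplicity, so for a nonempty tuple this is the order of its
-- stabiliser.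
canonicalImages : List ℕ → ℕ
canonicalImages xs = ∑ (dihedralImages xs) (𝟙 ∘ isCanonical)

𝟙-T : ∀ {b} → T b → 𝟙 b ≡ 1
𝟙-T {true} _ = refl

-- The lexicographically least image is canonical: by transitivity its own images are images of
-- `xs`, so none of them is smaller.
canonicalImages≥1 : ∀ xs → 0 < length xs → 1 ≤ canonicalImages xs
canonicalImages≥1 xs 0<n with lex-minimum (~-refl xs 0<n)
... | ys , xs~ys , ys≤ = subst (_≤ canonicalImages xs) (𝟙-T canonical) (∑-∈-≤ (𝟙 ∘ isCanonical) xs~ys)
  where
  canonical : T (isCanonical ys)
  canonical = All.all⁻ (lexLeq ys) (All.tabulate (λ ys~zs → All.lookup ys≤ (~-trans xs ys xs~ys ys~zs)))

-- Each of the two is an image of the other, so canonicity puts each below the other.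
canonical-unique : ∀ {xs ys zs} → xs ~ ys → xs ~ zs → T (isCanonical ys) → T (isCanonical zs) → ys ≡ zs
canonical-unique {xs} {ys} {zs} xs~ys xs~zs cy cz = lexLeq-antisym ys zs
  (All.lookup (All.all⁺ (lexLeq ys) _ cy) (~-trans ys xs (~-sym xs xs~ys) xs~zs))
  (All.lookup (All.all⁺ (lexLeq zs) _ cz) (~-trans zs xs (~-sym xs xs~zs) xs~ys))

∑-at-most-one : ∀ {L : List A} (P : A → Bool) → Unique L →
  (∀ {y z} → y ∈ L → z ∈ L → T (P y) → T (P z) → y ≡ z) → ∑ L (𝟙 ∘ P) ≤ 1
∑-at-most-one P [] _ = z≤n
∑-at-most-one {L = x ∷ L} P (x∉ ∷ u) single with P x in eq
... | false = ∑-at-most-one P u (λ p q → single (there p) (there q))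
... | true  = s≤s (≤-reflexive (trans (∑-cong L none) (∑-zero L)))
  where
  none : ∀ {y} → y ∈ L → 𝟙 (P y) ≡ 0
  none {y} y∈ with P y in eq′
  ... | false = refl
  ... | true  = ⊥-elim (All.lookup x∉ y∈ (single (here refl) (there y∈) (subst T (sym eq) _) (subst T (sym eq′) _)))

-- Tuples with distinct entries have pairwise distinct images.

unique-position : ∀ {x : A} ps qs {ss ts} → Unique (ps ++ x ∷ ss) → ps ++ x ∷ ss ≡ qs ++ x ∷ ts → length ps ≡ length qs
unique-position []       []       _        _    = refl
unique-position []       (q ∷ qs) (x∉ ∷ _) refl = ⊥-elim (All.lookup x∉ (∈-++⁺ʳ qs (here refl)) refl)
unique-position (p ∷ ps) []       (x∉ ∷ _) refl = ⊥-elim (All.lookup x∉ (∈-++⁺ʳ ps (here refl)) refl)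
unique-position (p ∷ ps) (q ∷ qs) (_ ∷ u)  eq   = cong suc (unique-position ps qs u (∷-injectiveʳ eq))

Unique-resp-↭ : ∀ {xs ys : List ℕ} → xs ↭ ys → Unique xs → Unique ys
Unique-resp-↭ p = PermSetoid.Unique-resp-↭ (setoid ℕ) (↭⇒↭ₛ p)

-- The head of a rotation is the entry at the rotation index, and distinctness lets the index be
-- recovered from that entry.
rotate-injective : ∀ {xs i j} → Unique xs → i < length xs → j < length xs → rotate i xs ≡ rotate j xs → i ≡ j
rotate-injective {xs} {i} {j} u i<n j<n eq with split-at i xs i<n | split-at j xs j<n
... | ps , x , ss , refl , refl | qs , y , ts , eq′ , refl =
  unique-position ps qs u (trans eq′ (cong (λ z → qs ++ z ∷ ts) (sym x≡y)))
  where
  x≡y : x ≡ y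
  x≡y = ∷-injectiveˡ (trans (sym (rotate-++ ps (x ∷ ss)))
    (trans eq (trans (cong (rotate (length qs)) eq′) (rotate-++ qs (y ∷ ts)))))

-- Rotate a ∷ b ∷ c ∷ w and its reverse so that b comes first: c follows b in one, and a in the other.
¬rotates-to-reverse : ∀ {xs} → Unique xs → 3 ≤ length xs → xs rotates-to reverse xs → ⊥
¬rotates-to-reverse {a ∷ b ∷ c ∷ w} u (s≤s (s≤s (s≤s _))) r = contra
  where
  a≢c : a ≢ c
  a≢c = All.lookup (AllPairs.head u) (there (here refl))

  rs = reverse w ++ c ∷ []

  reverse≡ : reverse (a ∷ b ∷ c ∷ w) ≡ rs ++ b ∷ a ∷ []
  reverse≡ = trans (reverse-++ (a ∷ b ∷ []) (c ∷ w)) (cong (_++ b ∷ a ∷ []) (unfold-reverse c w))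

  ba : (a ∷ b ∷ c ∷ w) rotates-to (b ∷ a ∷ rs)
  ba = subst ((a ∷ b ∷ c ∷ w) rotates-to_) (trans (cong (rotate (length rs)) reverse≡) (rotate-++ rs (b ∷ a ∷ [])))
    (rotate-closed {(a ∷ b ∷ c ∷ w) rotates-to_} rotates-to-rotate-1 (length rs) r)

  contra : ⊥
  contra with ba
  ... | i , i<n , eq with split-at i (a ∷ b ∷ c ∷ w) i<n
  ... | ps , x , ss , eq′ , refl with trans eq (trans (cong (rotate (length ps)) eq′) (rotate-++ ps (x ∷ ss)))
  ... | eq″ with ∷-injectiveˡ eq″
  ... | refl with unique-position (a ∷ []) ps u eq′
  contra | i , i<n , eq | (p ∷ []) , x , ss , refl , refl | eq″ | refl | refl = a≢c (∷-injectiveˡ (∷-injectiveʳ eq″))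

-- A rotation that is also a reflection of `xs` would rotate to its own reversal. Length 3 matters:
-- with two entries, rotating once is reversing.
dihedralImages-unique : ∀ {xs} → Unique xs → 3 ≤ length xs → Unique (dihedralImages xs)
dihedralImages-unique {xs} u 3≤n = Unique.++⁺ rotations
  (subst Unique (sym (map-upTo _ (length xs))) (Unique.applyUpTo⁺₁ _ (length xs)
    (λ i<j j<n eq → <⇒≢ i<j (rotate-injective u (<-trans i<j j<n) j<n (reverse-injective eq)))))
  disjoint
  where
  rotations : Unique (map (λ i → rotate i xs) (upTo (length xs)))
  rotations = subst Unique (sym (map-upTo _ (length xs))) (Unique.applyUpTo⁺₁ _ (length xs)
    (λ i<j j<n eq → <⇒≢ i<j (rotate-injective u (<-trans i<j j<n) j<n eq)))

  disjoint : ∀ {ys} → ys ∈ map (λ i → rotate i xs) (upTo (length xs)) ×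
                      ys ∈ map (λ i → reverse (rotate i xs)) (upTo (length xs)) → ⊥
  disjoint (ys∈ , ys∈′) with ∈-map⁻ _ ys∈ | ∈-map⁻ _ ys∈′
  ... | i , i∈ , refl | j , j∈ , eq = ¬rotates-to-reverse
    (Unique-resp-↭ (↭-sym (rotate-↭ i xs)) u)
    (subst (3 ≤_) (sym (↭-length (rotate-↭ i xs))) 3≤n)
    (rotates-to-trans (rotates-to-sym {xs} (i , ∈-upTo⁻ i∈ , refl))
      (j , ∈-upTo⁻ j∈ , trans (cong reverse eq) (reverse-involutive _)))

canonicalImages≤1 : ∀ {xs} → Unique xs → 3 ≤ length xs → canonicalImages xs ≤ 1
canonicalImages≤1 {xs} u 3≤n = ∑-at-most-one isCanonical (dihedralImages-unique u 3≤n) (canonical-unique {xs})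

-- Averaging over rotations and reflections.

module _ (m n : ℕ) where

  private
    𝒞 = compositions m n

  rotate-rotate-inverse : ∀ {i} xs → i ≤ m → length xs ≡ m → rotate i (rotate (m ∸ i) xs) ≡ xs
  rotate-rotate-inverse {i} xs i≤m len = trans
    (cong (λ j → rotate j (rotate (m ∸ i) xs)) (sym (m∸[m∸n]≡n i≤m))) (rotate-inverse (m ∸ i) xs len)

  ∑-rotate : ∀ {i} → i ≤ m → ∀ f → ∑ 𝒞 (f ∘ rotate i) ≡ ∑ 𝒞 f
  ∑-rotate {i} i≤m = ∑-compositions-invariant m n (rotate i) (rotate (m ∸ i)) (rotate-↭ i) (rotate-↭ (m ∸ i))
    (rotate-inverse i) (λ xs → rotate-rotate-inverse xs i≤m)

  ∑-reverse : ∀ f → ∑ 𝒞 (f ∘ reverse) ≡ ∑ 𝒞 f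
  ∑-reverse = ∑-compositions-invariant m n reverse reverse ↭-reverse ↭-reverse
    (λ xs _ → reverse-involutive xs) (λ xs _ → reverse-involutive xs)

  ∑-average : ∀ {f} (g : ℕ → List ℕ → List ℕ) → (∀ {i} → i < m → ∑ 𝒞 (f ∘ g i) ≡ ∑ 𝒞 f) →
    ∑ 𝒞 (λ xs → ∑ (upTo m) (λ i → f (g i xs))) ≡ m * ∑ 𝒞 f
  ∑-average {f} g inv = begin
    ∑ 𝒞 (λ xs → ∑ (upTo m) (λ i → f (g i xs))) ≡⟨ ∑-swap 𝒞 (upTo m) (λ xs i → f (g i xs)) ⟩
    ∑ (upTo m) (λ i → ∑ 𝒞 (f ∘ g i))           ≡⟨ ∑-cong (upTo m) (inv ∘ ∈-upTo⁻) ⟩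
    ∑ (upTo m) (λ _ → ∑ 𝒞 f)                   ≡⟨ ∑-const (upTo m) (∑ 𝒞 f) ⟩
    length (upTo m) * ∑ 𝒞 f                    ≡⟨ cong (_* ∑ 𝒞 f) (length-upTo m) ⟩
    m * ∑ 𝒞 f                                  ∎
    where open ≡-Reasoning

  ∑-rotations : ∀ f → ∑ 𝒞 (λ xs → ∑ (upTo m) (λ i → f (rotate i xs))) ≡ m * ∑ 𝒞 f
  ∑-rotations f = ∑-average {f} rotate (λ i<m → ∑-rotate (<⇒≤ i<m) f)

  -- After the sums are interchanged, each of the 2m maps contributes the same total, because it
  -- permutes the compositions. This takes the place of orbit counting.
  ∑-dihedralImages : ∀ f → ∑ 𝒞 (λ xs → ∑ (dihedralImages xs) f) ≡ (2 * m) * ∑ 𝒞 f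
  ∑-dihedralImages f = begin
    ∑ 𝒞 (λ xs → ∑ (dihedralImages xs) f)
      ≡⟨ ∑-cong 𝒞 expand ⟩
    ∑ 𝒞 (λ xs → ∑ (upTo m) (λ i → f (rotate i xs)) + ∑ (upTo m) (λ i → f (reverse (rotate i xs))))
      ≡⟨ ∑-distrib-+ 𝒞 _ _ ⟩
    ∑ 𝒞 (λ xs → ∑ (upTo m) (λ i → f (rotate i xs))) + ∑ 𝒞 (λ xs → ∑ (upTo m) (λ i → f (reverse (rotate i xs))))
      ≡⟨ cong₂ _+_ (∑-rotations f) (∑-average {f} (λ i → reverse ∘ rotate i)
           (λ i<m → trans (∑-rotate (<⇒≤ i<m) (f ∘ reverse)) (∑-reverse f))) ⟩
    m * ∑ 𝒞 f + m * ∑ 𝒞 f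
      ≡⟨ solve 2 (λ m s → m :* s :+ m :* s := (con 2 :* m) :* s) refl m (∑ 𝒞 f) ⟩
    (2 * m) * ∑ 𝒞 f ∎
    where
    open ≡-Reasoning
    open +-*-Solver
    expand : ∀ {xs} → xs ∈ 𝒞 → ∑ (dihedralImages xs) f ≡
      ∑ (upTo m) (λ i → f (rotate i xs)) + ∑ (upTo m) (λ i → f (reverse (rotate i xs)))
    expand {xs} xs∈ with ∈-compositions⁻ m n xs∈
    ... | refl , _ = trans (∑-++ (map (λ i → rotate i xs) (upTo m)) _ f)
                           (cong₂ _+_ (∑-map _ (upTo m) f) (∑-map _ (upTo m) f))

hd : List ℕ → ℕ
hd []      = 0
hd (x ∷ _) = x

-- The list v i is a placeholder for the tail take i xs of rotate i xs, which would otherwise block the induction.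
∑-as-heads : ∀ xs (w : ℕ → ℕ) (v : ℕ → List ℕ) →
  ∑ xs w ≡ ∑ (upTo (length xs)) (λ i → w (hd (drop i xs ++ v i)))
∑-as-heads []       w v = refl
∑-as-heads (x ∷ xs) w v = trans (cong (w x +_) (∑-as-heads xs w (v ∘ suc)))
  (sym (∑-upTo-suc (length xs) (λ i → w (hd (drop i (x ∷ xs) ++ v i)))))

-- Every position becomes the head of exactly one of the m rotations, so all positions contribute
-- equally.
∑-entries : ∀ m n (w : ℕ → ℕ) → ∑ (compositions m n) (λ xs → ∑ xs w) ≡ m * ∑ (compositions m n) (w ∘ hd)
∑-entries m n w = trans (∑-cong (compositions m n) expand) (∑-rotations m n (w ∘ hd))
  where
  expand : ∀ {xs} → xs ∈ compositions m n → ∑ xs w ≡ ∑ (upTo m) (λ i → w (hd (rotate i xs)))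
  expand {xs} xs∈ with ∈-compositions⁻ m n xs∈
  ... | refl , _ = ∑-as-heads xs w (λ i → take i xs)

-- The number of compositions as a binomial coefficient.

∑-compositions-suc : ∀ m n f → ∑ (compositions (suc m) n) f ≡
  ∑ (upTo n) (λ i → ∑ (compositions m (n ∸ suc i)) (λ xs → f (suc i ∷ xs)))
∑-compositions-suc m n f = trans (∑-concatMap (λ i → map (suc i ∷_) (compositions m (n ∸ suc i))) (upTo n) f)
  (∑-cong (upTo n) (λ {i} _ → ∑-map (suc i ∷_) (compositions m (n ∸ suc i)) f))

#compositions : ℕ → ℕ → ℕ
#compositions m n = length (compositions m n)

∑-const-compositions : ∀ m n c → ∑ (compositions m n) (λ _ → c) ≡ c * #compositions m n
∑-const-compositions m n c = trans (∑-const (compositions m n) c) (*-comm (#compositions m n) c)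

length≡∑ : ∀ (xs : List A) → length xs ≡ ∑ xs (λ _ → 1)
length≡∑ xs = sym (trans (∑-const xs 1) (*-identityʳ (length xs)))

#compositions-suc : ∀ m n → #compositions (suc m) n ≡ ∑ (upTo n) (λ i → #compositions m (n ∸ suc i))
#compositions-suc m n = begin
  #compositions (suc m) n                                     ≡⟨ length≡∑ (compositions (suc m) n) ⟩
  ∑ (compositions (suc m) n) (λ _ → 1)                        ≡⟨ ∑-compositions-suc m n (λ _ → 1) ⟩
  ∑ (upTo n) (λ i → ∑ (compositions m (n ∸ suc i)) (λ _ → 1)) ≡⟨ ∑-cong (upTo n) (λ {i} _ → sym (length≡∑ (compositions m (n ∸ suc i)))) ⟩
  ∑ (upTo n) (λ i → #compositions m (n ∸ suc i))              ∎
  where open ≡-Reasoning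

-- Pascal's rule: first part 1 is split off, and larger first parts are lowered by one.
#compositions-pascal : ∀ m n → #compositions (suc m) (suc n) ≡ #compositions m n + #compositions (suc m) n
#compositions-pascal m n = begin
  #compositions (suc m) (suc n)                                     ≡⟨ #compositions-suc m (suc n) ⟩
  ∑ (upTo (suc n)) (λ i → #compositions m (suc n ∸ suc i))          ≡⟨ ∑-upTo-suc n (λ i → #compositions m (suc n ∸ suc i)) ⟩
  #compositions m n + ∑ (upTo n) (λ i → #compositions m (n ∸ suc i)) ≡⟨ cong (#compositions m n +_) (sym (#compositions-suc m n)) ⟩
  #compositions m n + #compositions (suc m) n                       ∎
  where open ≡-Reasoning

#compositions-1 : ∀ n → #compositions 1 (suc n) ≡ 1
#compositions-1 zero    = refl
#compositions-1 (suc n) = trans (#compositions-pascal 0 (suc n)) (#compositions-1 n)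

-- The absorption identity (d+1) C(n+1,d+1) = (n+1) C(n,d), since #compositions (d+1) (n+1) = C(n,d).
#compositions-absorption : ∀ d n → suc d * #compositions (2 + d) (2 + n) ≡ suc n * #compositions (1 + d) (1 + n)
#compositions-absorption zero zero = refl
#compositions-absorption (suc d) zero = trans
  (cong (suc (suc d) *_) (trans (#compositions-pascal (2 + d) 1) (cong₂ _+_ B≡0 (#compositions-pascal (2 + d) 0))))
  (trans (*-zeroʳ (suc (suc d))) (sym (trans (*-identityˡ _) B≡0)))
  where
  B≡0 : #compositions (2 + d) 1 ≡ 0
  B≡0 = #compositions-pascal (1 + d) 0
#compositions-absorption zero (suc n) = begin
  1 * #compositions 2 (3 + n)                       ≡⟨ *-identityˡ _ ⟩
  #compositions 2 (3 + n)                           ≡⟨ #compositions-pascal 1 (2 + n) ⟩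
  #compositions 1 (2 + n) + #compositions 2 (2 + n) ≡⟨ cong₂ _+_ (#compositions-1 (suc n))
                                                         (trans (sym (*-identityˡ _)) (#compositions-absorption zero n)) ⟩
  1 + suc n * #compositions 1 (1 + n)               ≡⟨ cong (λ z → 1 + suc n * z) (#compositions-1 n) ⟩
  1 + suc n * 1                                     ≡⟨ cong (suc (suc n) *_) (sym (#compositions-1 (suc n))) ⟩
  suc (suc n) * #compositions 1 (2 + n)             ∎
  where open ≡-Reasoning
#compositions-absorption (suc d) (suc n) = begin
  suc (suc d) * #compositions (3 + d) (3 + n)        ≡⟨ cong (suc (suc d) *_) (#compositions-pascal (2 + d) (2 + n)) ⟩
  suc (suc d) * (y + z)                              ≡⟨ solve 3 (λ d y z → (con 2 :+ d) :* (y :+ z) := y :+ ((con 1 :+ d) :* y :+ (con 2 :+ d) :* z)) refl d y z ⟩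
  y + (suc d * y + suc (suc d) * z)                  ≡⟨ cong (y +_) (cong₂ _+_ (#compositions-absorption d n) (#compositions-absorption (suc d) n)) ⟩
  y + (suc n * #compositions (1 + d) (1 + n) + suc n * #compositions (2 + d) (1 + n))
    ≡⟨ cong (y +_) (trans (sym (*-distribˡ-+ (suc n) (#compositions (1 + d) (1 + n)) _)) (cong (suc n *_) (sym (#compositions-pascal (1 + d) (1 + n))))) ⟩
  suc (suc n) * y                                    ∎
  where
  open ≡-Reasoning
  open +-*-Solver
  y = #compositions (2 + d) (2 + n)
  z = #compositions (3 + d) (2 + n)

-- Repeated entries and the number of canonical images.

repeatsHead : List ℕ → ℕ
repeatsHead []       = 0
repeatsHead (x ∷ xs) = ∑ xs (λ y → 𝟙 (x ≡ᵇ y))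

-- As in `∑-as-heads`, `v i` stands for the part wrapped round to the end. It can only raise the
-- counts, so a vanishing sum makes each entry differ from all later ones.
no-repeats⇒unique : ∀ xs (v : ℕ → List ℕ) →
  ∑ (upTo (length xs)) (λ i → repeatsHead (drop i xs ++ v i)) ≡ 0 → Unique xs
no-repeats⇒unique []       v eq = []
no-repeats⇒unique (x ∷ xs) v eq = All.tabulate x≢ ∷ no-repeats⇒unique xs (v ∘ suc) (m+n≡0⇒n≡0 (repeatsHead (x ∷ xs ++ v 0)) eq′)
  where
  eq′ = trans (sym (∑-upTo-suc (length xs) (λ i → repeatsHead (drop i (x ∷ xs) ++ v i)))) eq
  head≡0 : ∑ xs (λ y → 𝟙 (x ≡ᵇ y)) ≡ 0
  head≡0 = m+n≡0⇒m≡0 _ (trans (sym (∑-++ xs (v 0) (λ y → 𝟙 (x ≡ᵇ y)))) (m+n≡0⇒m≡0 _ eq′))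
  x≢ : ∀ {y} → y ∈ xs → x ≢ y
  x≢ {y} y∈ x≡y = <⇒≱ (≤-reflexive (sym (𝟙-T (≡⇒≡ᵇ x y x≡y))))
    (≤-trans (∑-∈-≤ (λ y → 𝟙 (x ≡ᵇ y)) y∈) (≤-reflexive head≡0))

𝟙≤1 : ∀ b → 𝟙 b ≤ 1
𝟙≤1 true  = ≤-refl
𝟙≤1 false = z≤n

canonicalImages≤ : ∀ xs → canonicalImages xs ≤ 2 * length xs
canonicalImages≤ xs = begin
  canonicalImages xs               ≤⟨ ∑-mono (dihedralImages xs) (λ {ys} _ → 𝟙≤1 (isCanonical ys)) ⟩
  ∑ (dihedralImages xs) (λ _ → 1)  ≡⟨ sym (length≡∑ (dihedralImages xs)) ⟩
  length (dihedralImages xs)       ≡⟨ trans (length-++ (map (λ i → rotate i xs) is)) (cong₂ _+_ (len (λ i → rotate i xs)) (len (λ i → reverse (rotate i xs)))) ⟩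
  length xs + length xs            ≡⟨ cong (length xs +_) (sym (+-identityʳ (length xs))) ⟩
  2 * length xs                    ∎
  where
  open ≤-Reasoning
  is = upTo (length xs)
  len : (g : ℕ → List ℕ) → length (map g is) ≡ length xs
  len g = trans (length-map g is) (length-upTo (length xs))

-- Without a repetition there is at most one canonical image; otherwise a single repetition already
-- pays for all 2m images. The case distinction becomes a linear bound, ready to be summed.
canonicalImages-bound : ∀ xs → 3 ≤ length xs →
  canonicalImages xs ≤ 1 + 2 * length xs * ∑ (upTo (length xs)) (λ i → repeatsHead (rotate i xs))
canonicalImages-bound xs 3≤n with ∑ (upTo (length xs)) (λ i → repeatsHead (rotate i xs)) in eq
... | zero  = ≤-trans (canonicalImages≤1 (no-repeats⇒unique xs (λ i → take i xs) eq) 3≤n) (m≤m+n 1 _)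
... | suc r = ≤-trans (canonicalImages≤ xs) (≤-trans (m≤m*n (2 * length xs) (suc r)) (m≤n+m _ 1))

-- Double counting of polygon tuples and canonical images.

isPolygon : ℕ → List ℕ → Bool
isPolygon n xs = and (map (λ a → (2 * a) <ᵇ n) xs)

isPolygon-resp-↭ : ∀ n {xs ys} → xs ↭ ys → isPolygon n xs ≡ isPolygon n ys
isPolygon-resp-↭ n {xs} {ys} xs↭ys = T-ext (half xs↭ys) (half (↭-sym xs↭ys))
  where
  half : ∀ {xs ys} → xs ↭ ys → T (isPolygon n xs) → T (isPolygon n ys)
  half {xs} {ys} p t = All.all⁻ (λ a → (2 * a) <ᵇ n) (All-resp-↭ p (All.all⁺ (λ a → (2 * a) <ᵇ n) xs t))
  T-ext : ∀ {b c} → (T b → T c) → (T c → T b) → b ≡ c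
  T-ext {true}  {true}  f g = refl
  T-ext {true}  {false} f g = ⊥-elim (f _)
  T-ext {false} {true}  f g = ⊥-elim (g _)
  T-ext {false} {false} f g = refl

#polygons : ℕ → ℕ → ℕ
#polygons m n = ∑ (compositions m n) (𝟙 ∘ isPolygon n)

-- Averaging is applied to the indicator of canonical polygon tuples; the polygon condition is the
-- same for all images and factors out.
2m*p≡∑ : ∀ m n → 2 * m * p m n ≡ ∑ (compositions m n) (λ xs → 𝟙 (isPolygon n xs) * canonicalImages xs)
2m*p≡∑ m n = begin
  2 * m * p m n ≡⟨ cong (2 * m *_) (trans (length-filterᵇ isCanonical (polygonTuples m n)) (∑-filterᵇ (isPolygon n) 𝒞 (𝟙 ∘ isCanonical))) ⟩
  2 * m * ∑ 𝒞 f ≡⟨ sym (∑-dihedralImages m n f) ⟩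
  ∑ 𝒞 (λ xs → ∑ (dihedralImages xs) f) ≡⟨ ∑-cong 𝒞 (λ {xs} _ → pull xs) ⟩
  ∑ 𝒞 (λ xs → 𝟙 (isPolygon n xs) * canonicalImages xs) ∎
  where
  open ≡-Reasoning
  𝒞 = compositions m n
  f : List ℕ → ℕ
  f xs = 𝟙 (isPolygon n xs) * 𝟙 (isCanonical xs)
  pull : ∀ xs → ∑ (dihedralImages xs) f ≡ 𝟙 (isPolygon n xs) * canonicalImages xs
  pull xs = trans
    (∑-cong (dihedralImages xs) (λ {ys} ys∈ → cong (λ b → 𝟙 b * 𝟙 (isCanonical ys)) (isPolygon-resp-↭ n (∈-dihedralImages⇒↭ xs ys∈))))
    (∑-distribˡ-* (dihedralImages xs) (𝟙 (isPolygon n xs)) (𝟙 ∘ isCanonical))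

#polygons≤2m*p : ∀ m n → 0 < m → #polygons m n ≤ 2 * m * p m n
#polygons≤2m*p m n 0<m = ≤-trans (∑-mono (compositions m n) bound) (≤-reflexive (sym (2m*p≡∑ m n)))
  where
  bound : ∀ {xs} → xs ∈ compositions m n → 𝟙 (isPolygon n xs) ≤ 𝟙 (isPolygon n xs) * canonicalImages xs
  bound {xs} xs∈ with ∈-compositions⁻ m n xs∈
  ... | refl , _ = ≤-trans (≤-reflexive (sym (*-identityʳ _))) (*-monoʳ-≤ (𝟙 (isPolygon n xs)) (canonicalImages≥1 xs 0<m))

-- The repetition term is kept for non-polygons too, so that it runs over all compositions, where
-- rotation invariance applies.
2m*p≤ : ∀ m n → 3 ≤ m → 2 * m * p m n ≤ #polygons m n + 2 * m * (m * ∑ (compositions m n) repeatsHead)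
2m*p≤ m n 3≤m = begin
  2 * m * p m n                                                   ≡⟨ 2m*p≡∑ m n ⟩
  ∑ 𝒞 (λ xs → 𝟙 (isPolygon n xs) * canonicalImages xs)            ≤⟨ ∑-mono 𝒞 bound ⟩
  ∑ 𝒞 (λ xs → 𝟙 (isPolygon n xs) + 2 * m * repeats xs)            ≡⟨ ∑-distrib-+ 𝒞 (𝟙 ∘ isPolygon n) _ ⟩
  #polygons m n + ∑ 𝒞 (λ xs → 2 * m * repeats xs)                 ≡⟨ cong (#polygons m n +_) (∑-distribˡ-* 𝒞 (2 * m) repeats) ⟩
  #polygons m n + 2 * m * ∑ 𝒞 repeats                             ≡⟨ cong (λ z → #polygons m n + 2 * m * z) (∑-rotations m n repeatsHead) ⟩
  #polygons m n + 2 * m * (m * ∑ 𝒞 repeatsHead)                   ∎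
  where
  open ≤-Reasoning
  𝒞 = compositions m n
  repeats : List ℕ → ℕ
  repeats xs = ∑ (upTo m) (λ i → repeatsHead (rotate i xs))
  𝟙*≤ : ∀ b {c r} → c ≤ 1 + r → 𝟙 b * c ≤ 𝟙 b + r
  𝟙*≤ true  c≤ = ≤-trans (≤-reflexive (*-identityˡ _)) c≤
  𝟙*≤ false _  = z≤n
  bound : ∀ {xs} → xs ∈ 𝒞 → 𝟙 (isPolygon n xs) * canonicalImages xs ≤ 𝟙 (isPolygon n xs) + 2 * m * repeats xs
  bound {xs} xs∈ with ∈-compositions⁻ m n xs∈
  ... | refl , _ = 𝟙*≤ (isPolygon n xs) (canonicalImages-bound xs 3≤m)

-- Compositions with an entry of at least half the perimeter.

tooLong : ℕ → ℕ → ℕ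
tooLong n a = 𝟙 (not ((2 * a) <ᵇ n))

-- Summed over at least three positive entries of total n, this leaves room for only one too long entry.
tooLong-bound : ∀ n a → 0 < a → tooLong n a * n + 2 ≤ 2 * a + 2 * tooLong n a
tooLong-bound n a 0<a with (2 * a) <ᵇ n in eq
... | true  = ≤-trans (*-monoʳ-≤ 2 0<a) (m≤m+n (2 * a) 0)
... | false = +-monoˡ-≤ 2 (≤-trans (≤-reflexive (*-identityˡ n)) (≮⇒≥ (λ lt → subst T eq (<⇒<ᵇ lt))))

∑-tooLong-bound : ∀ n xs → All (0 <_) xs → ∑ xs (tooLong n) * n + 2 * length xs ≤ 2 * sum xs + 2 * ∑ xs (tooLong n)
∑-tooLong-bound n []       []          = z≤n
∑-tooLong-bound n (x ∷ xs) (0<x ∷ pos) = begin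
  (t + b) * n + 2 * suc (length xs)      ≡⟨ solve 4 (λ t b n l → (t :+ b) :* n :+ con 2 :* (con 1 :+ l) := (t :* n :+ con 2) :+ (b :* n :+ con 2 :* l)) refl t b n (length xs) ⟩
  (t * n + 2) + (b * n + 2 * length xs)  ≤⟨ +-mono-≤ (tooLong-bound n x 0<x) (∑-tooLong-bound n xs pos) ⟩
  (2 * x + 2 * t) + (2 * sum xs + 2 * b) ≡⟨ solve 4 (λ x t s b → (con 2 :* x :+ con 2 :* t) :+ (con 2 :* s :+ con 2 :* b) := con 2 :* (x :+ s) :+ con 2 :* (t :+ b)) refl x t (sum xs) b ⟩
  2 * (x + sum xs) + 2 * (t + b)         ∎
  where
  open ≤-Reasoning
  open +-*-Solver
  t = tooLong n x
  b = ∑ xs (tooLong n)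

-- With b + 2 too long entries the summed bound gives (b+2)n + 2m ≤ 2n + 2(b+2); n ≥ 2 and m ≥ 3
-- turn this into 6 ≤ 4. With only two entries, both could equal n/2.
∑-tooLong≤1 : ∀ m n {xs} → 3 ≤ m → 2 ≤ n → IsComposition m n xs → ∑ xs (tooLong n) ≤ 1
∑-tooLong≤1 m n {xs} 3≤m 2≤n (refl , refl , pos) with ∑ xs (tooLong n) in eq
... | zero        = z≤n
... | suc zero    = ≤-refl
... | suc (suc b) = ⊥-elim (<⇒≱ (+-monoʳ-< (2 * n + 2 * b) {4} {6} (s≤s (s≤s (s≤s (s≤s z<s))))) (begin
  2 * n + 2 * b + 6              ≤⟨ +-monoˡ-≤ 6 (+-monoʳ-≤ (2 * n) (≤-trans (≤-reflexive (*-comm 2 b)) (*-monoʳ-≤ b 2≤n))) ⟩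
  2 * n + b * n + 6              ≤⟨ +-monoʳ-≤ (2 * n + b * n) (*-monoʳ-≤ 2 3≤m) ⟩
  2 * n + b * n + 2 * m          ≡⟨ cong (_+ 2 * m) (sym (*-distribʳ-+ n 2 b)) ⟩
  suc (suc b) * n + 2 * m        ≤⟨ subst (λ t → t * n + 2 * m ≤ 2 * n + 2 * t) eq (∑-tooLong-bound n xs pos) ⟩
  2 * n + 2 * suc (suc b)        ≡⟨ solve 2 (λ n b → con 2 :* n :+ con 2 :* (con 2 :+ b) := con 2 :* n :+ con 2 :* b :+ con 4) refl n b ⟩
  2 * n + 2 * b + 4              ∎))
  where
  open ≤-Reasoning
  open +-*-Solver

-- When at most one entry is too long, the number of such entries is itself the indicator of
-- non-polygons.
isPolygon+tooLong≡1 : ∀ n xs → ∑ xs (tooLong n) ≤ 1 → 𝟙 (isPolygon n xs) + ∑ xs (tooLong n) ≡ 1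
isPolygon+tooLong≡1 n []       _  = refl
isPolygon+tooLong≡1 n (x ∷ xs) b≤1 with (2 * x) <ᵇ n
... | true  = isPolygon+tooLong≡1 n xs b≤1
... | false = ≤-antisym b≤1 (s≤s z≤n)

-- Reindexing the surviving terms i ≥ t from 0 recovers the recursion on the first part, with the
-- total lowered by t.
∑-above-threshold : ∀ t n (F : ℕ → ℕ) →
  ∑ (upTo n) (λ i → 𝟙 (not (i <ᵇ t)) * F (n ∸ suc i)) ≡ ∑ (upTo (n ∸ t)) (λ i → F (n ∸ t ∸ suc i))
∑-above-threshold zero    n       F = ∑-cong (upTo n) (λ {i} _ → *-identityˡ (F (n ∸ suc i)))
∑-above-threshold (suc t) zero    F = refl
∑-above-threshold (suc t) (suc n) F =
  trans (∑-upTo-suc n (λ i → 𝟙 (not (i <ᵇ suc t)) * F (n ∸ i))) (∑-above-threshold t n F)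

-- Both sides decide 2(i+1) ≤ n, and both are preserved when n drops by 2 and i by 1, which is the
-- recursion of `⌊_/2⌋`.
tooLong-threshold : ∀ n i → ((2 * suc i) <ᵇ suc n) ≡ (i <ᵇ ⌊ n /2⌋)
tooLong-threshold zero          i       = refl
tooLong-threshold (suc zero)    i       rewrite +-suc i (i + 0) = refl
tooLong-threshold (suc (suc n)) zero    = refl
tooLong-threshold (suc (suc n)) (suc i) rewrite +-suc i (suc (i + 0)) = tooLong-threshold n i

-- Subtracting `⌊ n /2⌋` from a too long first entry leaves it positive, and every composition of
-- the remaining total arises in this way.
∑-tooLong-head : ∀ m n → ∑ (compositions (suc m) (suc n)) (tooLong (suc n) ∘ hd) ≡ #compositions (suc m) (suc ⌈ n /2⌉)
∑-tooLong-head m n = begin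
  ∑ (compositions (suc m) (suc n)) (tooLong (suc n) ∘ hd)
    ≡⟨ ∑-compositions-suc m (suc n) (tooLong (suc n) ∘ hd) ⟩
  ∑ (upTo (suc n)) (λ i → ∑ (compositions m (n ∸ i)) (λ _ → tooLong (suc n) (suc i)))
    ≡⟨ ∑-cong (upTo (suc n)) (λ {i} _ → trans (∑-const-compositions m (n ∸ i) _)
         (cong (λ b → 𝟙 (not b) * #compositions m (n ∸ i)) (tooLong-threshold n i))) ⟩
  ∑ (upTo (suc n)) (λ i → 𝟙 (not (i <ᵇ ⌊ n /2⌋)) * #compositions m (suc n ∸ suc i))
    ≡⟨ ∑-above-threshold ⌊ n /2⌋ (suc n) (#compositions m) ⟩
  ∑ (upTo (suc n ∸ ⌊ n /2⌋)) (λ i → #compositions m (suc n ∸ ⌊ n /2⌋ ∸ suc i))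
    ≡⟨ sym (#compositions-suc m (suc n ∸ ⌊ n /2⌋)) ⟩
  #compositions (suc m) (suc n ∸ ⌊ n /2⌋)
    ≡⟨ cong (#compositions (suc m)) rest ⟩
  #compositions (suc m) (suc ⌈ n /2⌉) ∎
  where
  open ≡-Reasoning
  rest : suc n ∸ ⌊ n /2⌋ ≡ suc ⌈ n /2⌉
  rest = trans (cong (λ k → suc k ∸ ⌊ n /2⌋) (sym (⌊n/2⌋+⌈n/2⌉≡n n)))
    (trans (cong (_∸ ⌊ n /2⌋) (sym (+-suc ⌊ n /2⌋ ⌈ n /2⌉))) (m+n∸m≡n ⌊ n /2⌋ (suc ⌈ n /2⌉)))

#polygons-formula : ∀ m n → 2 ≤ m → 1 ≤ n →
  #polygons (suc m) (suc n) + suc m * #compositions (suc m) (suc ⌈ n /2⌉) ≡ #compositions (suc m) (suc n)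
#polygons-formula m n 2≤m 1≤n = begin
  #polygons (suc m) N + suc m * #compositions (suc m) (suc ⌈ n /2⌉) ≡⟨ cong (λ z → #polygons (suc m) N + suc m * z) (sym (∑-tooLong-head m n)) ⟩
  #polygons (suc m) N + suc m * ∑ 𝒞 (tooLong N ∘ hd)                ≡⟨ cong (#polygons (suc m) N +_) (sym (∑-entries (suc m) N (tooLong N))) ⟩
  #polygons (suc m) N + ∑ 𝒞 (λ xs → ∑ xs (tooLong N))               ≡⟨ sym (∑-distrib-+ 𝒞 (𝟙 ∘ isPolygon N) _) ⟩
  ∑ 𝒞 (λ xs → 𝟙 (isPolygon N xs) + ∑ xs (tooLong N))                ≡⟨ ∑-cong 𝒞 (λ {xs} xs∈ → isPolygon+tooLong≡1 N xs
                                                                         (∑-tooLong≤1 (suc m) N (s≤s 2≤m) (s≤s 1≤n) (∈-compositions⁻ (suc m) N xs∈))) ⟩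
  ∑ 𝒞 (λ _ → 1)                                                     ≡⟨ sym (length≡∑ 𝒞) ⟩
  #compositions (suc m) N                                           ∎
  where
  open ≡-Reasoning
  N = suc n
  𝒞 = compositions (suc m) N

-- Polynomial bounds with error one degree lower.

!-absorption : ∀ d n → suc d * d ! * #compositions (2 + d) (2 + n) ≡ suc n * (d ! * #compositions (1 + d) (1 + n))
!-absorption d n = begin
  suc d * d ! * #compositions (2 + d) (2 + n)   ≡⟨ cong (_* #compositions (2 + d) (2 + n)) (*-comm (suc d) (d !)) ⟩
  d ! * suc d * #compositions (2 + d) (2 + n)   ≡⟨ *-assoc (d !) (suc d) _ ⟩
  d ! * (suc d * #compositions (2 + d) (2 + n)) ≡⟨ cong (d ! *_) (#compositions-absorption d n) ⟩
  d ! * (suc n * #compositions (1 + d) (1 + n)) ≡⟨ *-assoc (d !) (suc n) _ ⟨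
  d ! * suc n * #compositions (1 + d) (1 + n)   ≡⟨ cong (_* #compositions (1 + d) (1 + n)) (*-comm (d !) (suc n)) ⟩
  suc n * d ! * #compositions (1 + d) (1 + n)   ≡⟨ *-assoc (suc n) (d !) _ ⟩
  suc n * (d ! * #compositions (1 + d) (1 + n)) ∎
  where open ≡-Reasoning

-- The left side is the falling factorial n(n-1)...(n-d+1), whose factors are at most n.
#compositions-upper : ∀ d n → d ! * #compositions (1 + d) (1 + n) ≤ n ^ d
#compositions-upper zero    n       = ≤-reflexive (trans (*-identityˡ _) (#compositions-1 n))
#compositions-upper (suc d) zero    = ≤-reflexive (trans (cong (suc d ! *_) (#compositions-pascal (suc d) 0)) (*-zeroʳ (suc d !)))
#compositions-upper (suc d) (suc n) = begin
  suc d * d ! * #compositions (2 + d) (2 + n)   ≡⟨ !-absorption d n ⟩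
  suc n * (d ! * #compositions (1 + d) (1 + n)) ≤⟨ *-monoʳ-≤ (suc n) (#compositions-upper d n) ⟩
  suc n * n ^ d                                 ≤⟨ *-monoʳ-≤ (suc n) (^-monoˡ-≤ d (n≤1+n n)) ⟩
  suc n * suc n ^ d                             ∎
  where open ≤-Reasoning

-- The shift by d makes the factors n+1, ..., n+d, each at least n, without any subtraction.
#compositions-lower : ∀ d n → n ^ d ≤ d ! * #compositions (1 + d) (1 + (n + d))
#compositions-lower zero    n = ≤-reflexive (sym (trans (*-identityˡ _) (#compositions-1 (n + 0))))
#compositions-lower (suc d) n = begin
  n * n ^ d                                                 ≤⟨ *-mono-≤ (m≤n⇒m≤1+n (m≤m+n n d)) (#compositions-lower d n) ⟩
  suc (n + d) * (d ! * #compositions (1 + d) (1 + (n + d))) ≡⟨ !-absorption d (n + d) ⟨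
  suc d * d ! * #compositions (2 + d) (2 + (n + d))         ≡⟨ cong (λ k → suc d ! * #compositions (2 + d) (1 + k)) (+-suc n d) ⟨
  suc d ! * #compositions (2 + d) (1 + (n + suc d))         ∎
  where open ≤-Reasoning

#compositions≤^ : ∀ d n → #compositions (1 + d) n ≤ n ^ d
#compositions≤^ d zero    = z≤n
#compositions≤^ d (suc n) = begin
  #compositions (1 + d) (1 + n)       ≤⟨ m≤n*m _ (d !) {{d !≢0}} ⟩
  d ! * #compositions (1 + d) (1 + n) ≤⟨ #compositions-upper d n ⟩
  n ^ d                               ≤⟨ ^-monoˡ-≤ d (n≤1+n n) ⟩
  suc n ^ d                           ∎
  where open ≤-Reasoning

-- A discrete mean value estimate: moving the base by at most c costs c times the derivative at the
-- larger end. It turns bounded shifts into errors of lower degree.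
^-perturb : ∀ e {x z} c → x ≤ z → z ≤ x + c → z ^ suc e ≤ x ^ suc e + c * suc e * z ^ e
^-perturb zero    {x} {z} c x≤z z≤x+c = begin
  z * 1                   ≡⟨ *-identityʳ z ⟩
  z                       ≤⟨ z≤x+c ⟩
  x + c                   ≡⟨ solve 2 (λ x c → x :+ c := x :* con 1 :+ c :* con 1 :* con 1) refl x c ⟩
  x * 1 + c * 1 * 1       ∎
  where
  open ≤-Reasoning
  open +-*-Solver
^-perturb (suc e) {x} {z} c x≤z z≤x+c = begin
  z * Z                              ≤⟨ *-monoˡ-≤ Z z≤x+c ⟩
  (x + c) * Z                        ≡⟨ *-distribʳ-+ Z x c ⟩
  x * Z + c * Z                      ≤⟨ +-monoˡ-≤ (c * Z) (*-monoʳ-≤ x (^-perturb e c x≤z z≤x+c)) ⟩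
  x * (X + c * suc e * z ^ e) + c * Z ≡⟨ solve 6 (λ x X c e w Z → x :* (X :+ c :* e :* w) :+ c :* Z := x :* X :+ (c :* e :* (x :* w) :+ c :* Z)) refl x X c (suc e) (z ^ e) Z ⟩
  x * X + (c * suc e * (x * z ^ e) + c * Z) ≤⟨ +-monoʳ-≤ (x * X) (+-monoˡ-≤ (c * Z) (*-monoʳ-≤ (c * suc e) (*-monoˡ-≤ (z ^ e) x≤z))) ⟩
  x * X + (c * suc e * Z + c * Z)    ≡⟨ solve 4 (λ xX c e Z → xX :+ (c :* e :* Z :+ c :* Z) := xX :+ c :* (con 1 :+ e) :* Z) refl (x * X) c (suc e) Z ⟩
  x * X + c * suc (suc e) * Z        ∎
  where
  open ≤-Reasoning
  open +-*-Solver
  X = x ^ suc e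
  Z = z ^ suc e

-- There are n choices for the head and 2 + k positions for an entry equal to it; the other 1 + k
-- entries have a prescribed total, which leaves at most n^k choices.
∑-repeatsHead : ∀ k n → ∑ (compositions (3 + k) n) repeatsHead ≤ (2 + k) * n ^ suc k
∑-repeatsHead k n = begin
  ∑ (compositions (3 + k) n) repeatsHead
    ≡⟨ ∑-compositions-suc (2 + k) n repeatsHead ⟩
  ∑ (upTo n) (λ i → ∑ (compositions (2 + k) (n ∸ suc i)) (λ xs → ∑ xs (λ y → 𝟙 (suc i ≡ᵇ y))))
    ≤⟨ ∑-mono (upTo n) (λ {i} _ → bound i) ⟩
  ∑ (upTo n) (λ _ → (2 + k) * n ^ k)
    ≡⟨ trans (∑-const (upTo n) _) (cong (_* ((2 + k) * n ^ k)) (length-upTo n)) ⟩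
  n * ((2 + k) * n ^ k)
    ≡⟨ solve 3 (λ n c w → n :* (c :* w) := c :* (n :* w)) refl n (2 + k) (n ^ k) ⟩
  (2 + k) * n ^ suc k ∎
  where
  open ≤-Reasoning
  open +-*-Solver
  bound : ∀ i → ∑ (compositions (2 + k) (n ∸ suc i)) (λ xs → ∑ xs (λ y → 𝟙 (suc i ≡ᵇ y))) ≤ (2 + k) * n ^ k
  bound i = begin
    ∑ (compositions (2 + k) r) (λ xs → ∑ xs (λ y → 𝟙 (suc i ≡ᵇ y)))
      ≡⟨ ∑-entries (2 + k) r (λ y → 𝟙 (suc i ≡ᵇ y)) ⟩
    (2 + k) * ∑ (compositions (2 + k) r) (λ xs → 𝟙 (suc i ≡ᵇ hd xs))
      ≡⟨ cong ((2 + k) *_) (∑-compositions-suc (1 + k) r (λ xs → 𝟙 (suc i ≡ᵇ hd xs))) ⟩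
    (2 + k) * ∑ (upTo r) (λ j → ∑ (compositions (1 + k) (r ∸ suc j)) (λ _ → 𝟙 (i ≡ᵇ j)))
      ≤⟨ *-monoʳ-≤ (2 + k) (∑-mono (upTo r) (λ {j} _ → each j)) ⟩
    (2 + k) * ∑ (upTo r) (λ j → n ^ k * 𝟙 (i ≡ᵇ j))
      ≡⟨ cong ((2 + k) *_) (∑-distribˡ-* (upTo r) (n ^ k) (λ j → 𝟙 (i ≡ᵇ j))) ⟩
    (2 + k) * (n ^ k * ∑ (upTo r) (λ j → 𝟙 (i ≡ᵇ j)))
      ≤⟨ *-monoʳ-≤ (2 + k) (*-monoʳ-≤ (n ^ k) (∑-at-most-one (i ≡ᵇ_) (Unique.upTo⁺ r)
           (λ {y} {z} _ _ p q → trans (sym (≡ᵇ⇒≡ i y p)) (≡ᵇ⇒≡ i z q)))) ⟩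
    (2 + k) * (n ^ k * 1)
      ≡⟨ cong ((2 + k) *_) (*-identityʳ (n ^ k)) ⟩
    (2 + k) * n ^ k ∎
    where
    r = n ∸ suc i
    each : ∀ j → ∑ (compositions (1 + k) (r ∸ suc j)) (λ _ → 𝟙 (i ≡ᵇ j)) ≤ n ^ k * 𝟙 (i ≡ᵇ j)
    each j = begin
      ∑ (compositions (1 + k) (r ∸ suc j)) (λ _ → 𝟙 (i ≡ᵇ j)) ≡⟨ ∑-const (compositions (1 + k) (r ∸ suc j)) (𝟙 (i ≡ᵇ j)) ⟩
      #compositions (1 + k) (r ∸ suc j) * 𝟙 (i ≡ᵇ j)          ≤⟨ *-monoˡ-≤ (𝟙 (i ≡ᵇ j)) (#compositions≤^ k (r ∸ suc j)) ⟩
      (r ∸ suc j) ^ k * 𝟙 (i ≡ᵇ j)                            ≤⟨ *-monoˡ-≤ (𝟙 (i ≡ᵇ j)) (^-monoˡ-≤ k (≤-trans (m∸n≤m r (suc j)) (m∸n≤m n (suc i)))) ⟩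
      n ^ k * 𝟙 (i ≡ᵇ j)                                      ∎

#compositions-lower′ : ∀ d {n} → d ≤ n → (n ∸ d) ^ d ≤ d ! * #compositions (1 + d) (1 + n)
#compositions-lower′ d {n} d≤n = subst (λ k → (n ∸ d) ^ d ≤ d ! * #compositions (1 + d) (1 + k)) (m∸n+n≡m d≤n)
  (#compositions-lower d (n ∸ d))

^-distribʳ-* : ∀ x y d → (x * y) ^ d ≡ x ^ d * y ^ d
^-distribʳ-* x y zero    = refl
^-distribʳ-* x y (suc d) = trans (cong (x * y *_) (^-distribʳ-* x y d)) ([m*n]*[o*p]≡[m*o]*[n*p] x y (x ^ d) (y ^ d))

2*⌈n/2⌉≤1+n : ∀ n → 2 * ⌈ n /2⌉ ≤ suc n
2*⌈n/2⌉≤1+n zero          = z≤n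
2*⌈n/2⌉≤1+n (suc zero)    = ≤-refl
2*⌈n/2⌉≤1+n (suc (suc n)) = ≤-trans (≤-reflexive (*-suc 2 ⌈ n /2⌉)) (s≤s (s≤s (2*⌈n/2⌉≤1+n n)))

n≤2*⌈n/2⌉ : ∀ n → n ≤ 2 * ⌈ n /2⌉
n≤2*⌈n/2⌉ zero          = z≤n
n≤2*⌈n/2⌉ (suc zero)    = s≤s z≤n
n≤2*⌈n/2⌉ (suc (suc n)) = ≤-trans (s≤s (s≤s (n≤2*⌈n/2⌉ n))) (≤-reflexive (sym (*-suc 2 ⌈ n /2⌉)))

-- Writing d as e + 1 names the error order n^e without subtraction. The condition on `n₀` gives d ≤
-- r, so that `n₀ ∸ d` and `r ∸ d` are true differences.
module Bounds (e n₀ : ℕ) (2d≤n₀ : 2 * suc e ≤ n₀) where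

  private
    d = suc e
    n = suc n₀
    r = ⌈ n₀ /2⌉
    U = 2 ^ d * d !
    a = #compositions (suc d) n
    b = #compositions (suc d) (suc r)

    d≤r : d ≤ r
    d≤r = *-cancelˡ-≤ 2 (≤-trans 2d≤n₀ (n≤2*⌈n/2⌉ n₀))

    d≤n₀ : d ≤ n₀
    d≤n₀ = ≤-trans (m≤n*m d 2) 2d≤n₀

  all-upper : U * a ≤ 2 ^ d * n ^ d
  all-upper = begin
    2 ^ d * d ! * a   ≡⟨ *-assoc (2 ^ d) (d !) a ⟩
    2 ^ d * (d ! * a) ≤⟨ *-monoʳ-≤ (2 ^ d) (≤-trans (#compositions-upper d n₀) (^-monoˡ-≤ d (n≤1+n n₀))) ⟩
    2 ^ d * n ^ d     ∎
    where open ≤-Reasoning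

  all-lower : 2 ^ d * n ^ d ≤ U * a + 2 ^ d * (suc d * d) * n ^ e
  all-lower = begin
    -- The base `n₀ ∸ d` lies exactly d + 1 below n, whence the factor `suc d`.
    2 ^ d * n ^ d                                     ≤⟨ *-monoʳ-≤ (2 ^ d) (^-perturb e (suc d) (≤-trans (m∸n≤m n₀ d) (n≤1+n n₀)) n≤) ⟩
    2 ^ d * ((n₀ ∸ d) ^ d + suc d * d * n ^ e)        ≤⟨ *-monoʳ-≤ (2 ^ d) (+-monoˡ-≤ (suc d * d * n ^ e) (#compositions-lower′ d d≤n₀)) ⟩
    2 ^ d * (d ! * a + suc d * d * n ^ e)             ≡⟨ solve 5 (λ t f a s w → t :* (f :* a :+ s :* w) := t :* f :* a :+ t :* s :* w) refl (2 ^ d) (d !) a (suc d * d) (n ^ e) ⟩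
    U * a + 2 ^ d * (suc d * d) * n ^ e               ∎
    where
    open ≤-Reasoning
    open +-*-Solver
    n≤ : n ≤ n₀ ∸ d + suc d
    n≤ = ≤-reflexive (sym (trans (+-suc (n₀ ∸ d) d) (cong suc (m∸n+n≡m d≤n₀))))

  long-upper : U * b ≤ n ^ d
  long-upper = begin
    2 ^ d * d ! * b   ≡⟨ *-assoc (2 ^ d) (d !) b ⟩
    2 ^ d * (d ! * b) ≤⟨ *-monoʳ-≤ (2 ^ d) (#compositions-upper d r) ⟩
    2 ^ d * r ^ d     ≡⟨ ^-distribʳ-* 2 r d ⟨
    (2 * r) ^ d       ≤⟨ ^-monoˡ-≤ d (2*⌈n/2⌉≤1+n n₀) ⟩
    n ^ d             ∎
    where open ≤-Reasoning

  long-lower : n ^ d ≤ U * b + suc (2 * d) * d * n ^ e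
  long-lower = begin
    -- The base 2(r - d) lies at most 2d + 1 below n, because n₀ ≤ 2r.
    n ^ d                                             ≤⟨ ^-perturb e (suc (2 * d)) (≤-trans (*-monoʳ-≤ 2 (m∸n≤m r d)) (2*⌈n/2⌉≤1+n n₀)) n≤ ⟩
    (2 * (r ∸ d)) ^ d + suc (2 * d) * d * n ^ e       ≡⟨ cong (_+ suc (2 * d) * d * n ^ e) (^-distribʳ-* 2 (r ∸ d) d) ⟩
    2 ^ d * (r ∸ d) ^ d + suc (2 * d) * d * n ^ e     ≤⟨ +-monoˡ-≤ (suc (2 * d) * d * n ^ e) (*-monoʳ-≤ (2 ^ d) (#compositions-lower′ d d≤r)) ⟩
    2 ^ d * (d ! * b) + suc (2 * d) * d * n ^ e       ≡⟨ cong (_+ suc (2 * d) * d * n ^ e) (*-assoc (2 ^ d) (d !) b) ⟨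
    U * b + suc (2 * d) * d * n ^ e                   ∎
    where
    open ≤-Reasoning
    n≤ : n ≤ 2 * (r ∸ d) + suc (2 * d)
    n≤ = begin
      suc n₀                       ≤⟨ s≤s (n≤2*⌈n/2⌉ n₀) ⟩
      suc (2 * r)                  ≡⟨ cong (λ z → suc (2 * z)) (m∸n+n≡m d≤r) ⟨
      suc (2 * (r ∸ d + d))        ≡⟨ cong suc (*-distribˡ-+ 2 (r ∸ d) d) ⟩
      suc (2 * (r ∸ d) + 2 * d)    ≡⟨ +-suc (2 * (r ∸ d)) (2 * d) ⟨
      2 * (r ∸ d) + suc (2 * d)    ∎

-- Transfer of inequalities from ℕ to ℚ.

fromℚᵘ-homo-* : ∀ u v → ℚ.fromℚᵘ u ℚ.* ℚ.fromℚᵘ v ≡ ℚ.fromℚᵘ (u ℚᵘ.* v)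
fromℚᵘ-homo-* u v = ℚ.toℚᵘ-injective (ℚᵘ.≃-trans (ℚ.toℚᵘ-homo-* (ℚ.fromℚᵘ u) (ℚ.fromℚᵘ v))
  (ℚᵘ.≃-trans (ℚᵘ.*-cong (ℚ.toℚᵘ-fromℚᵘ u) (ℚ.toℚᵘ-fromℚᵘ v)) (ℚᵘ.≃-sym (ℚ.toℚᵘ-fromℚᵘ (u ℚᵘ.* v)))))

fromℚᵘ-homo-+ : ∀ u v → ℚ.fromℚᵘ u ℚ.+ ℚ.fromℚᵘ v ≡ ℚ.fromℚᵘ (u ℚᵘ.+ v)
fromℚᵘ-homo-+ u v = ℚ.toℚᵘ-injective (ℚᵘ.≃-trans (ℚ.toℚᵘ-homo-+ (ℚ.fromℚᵘ u) (ℚ.fromℚᵘ v))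
  (ℚᵘ.≃-trans (ℚᵘ.+-cong (ℚ.toℚᵘ-fromℚᵘ u) (ℚ.toℚᵘ-fromℚᵘ v)) (ℚᵘ.≃-sym (ℚ.toℚᵘ-fromℚᵘ (u ℚᵘ.+ v)))))

-- Unnormalised fractions over 1 multiply to a fraction over 1 by computation, so the normalisation
-- inside ℚ is crossed only once.
ℕtoℚ-homo-* : ∀ x y → ℕtoℚ (x * y) ≡ ℕtoℚ x ℚ.* ℕtoℚ y
ℕtoℚ-homo-* x y = sym (trans (fromℚᵘ-homo-* (mkℚᵘ (ℤ.+ x) 0) (mkℚᵘ (ℤ.+ y) 0))
  (cong (ℚ._/ 1) (sym (ℤ.pos-* x y))))

ℕtoℚ-homo-+ : ∀ x y → ℕtoℚ (x + y) ≡ ℕtoℚ x ℚ.+ ℕtoℚ y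
ℕtoℚ-homo-+ x y = sym (trans (fromℚᵘ-homo-+ (mkℚᵘ (ℤ.+ x) 0) (mkℚᵘ (ℤ.+ y) 0))
  (cong (ℚ._/ 1) (cong₂ ℤ._+_ (ℤ.*-identityʳ (ℤ.+ x)) (ℤ.*-identityʳ (ℤ.+ y)))))

ℕtoℚ-mono-< : ∀ {x y} → x < y → ℕtoℚ x ℚ.< ℕtoℚ y
ℕtoℚ-mono-< {x} {y} x<y = ℚ.toℚᵘ-cancel-<
  (ℚᵘ.<-respʳ-≃ (ℚᵘ.≃-sym (ℚ.toℚᵘ-fromℚᵘ (mkℚᵘ (ℤ.+ y) 0)))
  (ℚᵘ.<-respˡ-≃ (ℚᵘ.≃-sym (ℚ.toℚᵘ-fromℚᵘ (mkℚᵘ (ℤ.+ x) 0)))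
  (*<* (ℤ.*-monoʳ-<-pos (ℤ.+ 1) (ℤ.+<+ x<y)))))

/-*-cancel : ∀ x q .{{_ : NonZero q}} → ((ℤ.+ x) ℚ./ q) ℚ.* ℕtoℚ q ≡ ℕtoℚ x
/-*-cancel x (suc q) = trans (fromℚᵘ-homo-* (mkℚᵘ (ℤ.+ x) q) (mkℚᵘ (ℤ.+ suc q) 0))
  (ℚ.fromℚᵘ-cong {mkℚᵘ (ℤ.+ x) q ℚᵘ.* mkℚᵘ (ℤ.+ suc q) 0} {mkℚᵘ (ℤ.+ x) 0} (*≡* (begin
    ℤ.+ x ℤ.* ℤ.+ suc q ℤ.* ℤ.+ 1 ≡⟨ ℤ.*-identityʳ _ ⟩
    ℤ.+ x ℤ.* ℤ.+ suc q         ≡⟨ cong (λ k → ℤ.+ x ℤ.* ℤ.+ k) (sym (*-identityʳ (suc q))) ⟩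
    ℤ.+ x ℤ.* ℤ.+ (suc q * 1)   ∎)))
  where open ≡-Reasoning

ℕtoℚ-nonNeg : ∀ x → ℚ.NonNegative (ℕtoℚ x)
ℕtoℚ-nonNeg x = ℚ.normalize-nonNeg x 1

-- The two hypotheses up and lo are the halves of |P − c X| < ε c X, cleared of the denominators q of c = a/q and v of ε = u/v.
module _ (ε c : ℚ) {a q u v : ℕ} (cq≡a : c ℚ.* ℕtoℚ q ≡ ℕtoℚ a) (εv≡u : ε ℚ.* ℕtoℚ v ≡ ℕtoℚ u) (P X : ℕ)
         (up : P * (q * v) < u * a * X + a * X * v) (lo : a * X * v < u * a * X + P * (q * v)) where

  private
    open ℚ-Solver.+-*-Solver

    y = ℕtoℚ P
    x = c ℚ.* ℕtoℚ X
    z = ε ℚ.* x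
    w = ℕtoℚ (q * v)

    y*w : y ℚ.* w ≡ ℕtoℚ (P * (q * v))
    y*w = sym (ℕtoℚ-homo-* P (q * v))

    x*w : x ℚ.* w ≡ ℕtoℚ (a * X * v)
    x*w = begin
      c ℚ.* ℕtoℚ X ℚ.* ℕtoℚ (q * v)            ≡⟨ cong (c ℚ.* ℕtoℚ X ℚ.*_) (ℕtoℚ-homo-* q v) ⟩
      c ℚ.* ℕtoℚ X ℚ.* (ℕtoℚ q ℚ.* ℕtoℚ v)     ≡⟨ solve 4 (λ c X q v → c :* X :* (q :* v) := c :* q :* X :* v) refl c (ℕtoℚ X) (ℕtoℚ q) (ℕtoℚ v) ⟩
      c ℚ.* ℕtoℚ q ℚ.* ℕtoℚ X ℚ.* ℕtoℚ v       ≡⟨ cong (λ t → t ℚ.* ℕtoℚ X ℚ.* ℕtoℚ v) cq≡a ⟩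
      ℕtoℚ a ℚ.* ℕtoℚ X ℚ.* ℕtoℚ v             ≡⟨ cong (ℚ._* ℕtoℚ v) (sym (ℕtoℚ-homo-* a X)) ⟩
      ℕtoℚ (a * X) ℚ.* ℕtoℚ v                  ≡⟨ sym (ℕtoℚ-homo-* (a * X) v) ⟩
      ℕtoℚ (a * X * v)                         ∎
      where open ≡-Reasoning

    z*w : z ℚ.* w ≡ ℕtoℚ (u * a * X)
    z*w = begin
      ε ℚ.* (c ℚ.* ℕtoℚ X) ℚ.* ℕtoℚ (q * v)          ≡⟨ cong (z ℚ.*_) (ℕtoℚ-homo-* q v) ⟩
      ε ℚ.* (c ℚ.* ℕtoℚ X) ℚ.* (ℕtoℚ q ℚ.* ℕtoℚ v)   ≡⟨ solve 5 (λ ε c X q v → ε :* (c :* X) :* (q :* v) := ε :* v :* (c :* q) :* X) refl ε c (ℕtoℚ X) (ℕtoℚ q) (ℕtoℚ v) ⟩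
      ε ℚ.* ℕtoℚ v ℚ.* (c ℚ.* ℕtoℚ q) ℚ.* ℕtoℚ X     ≡⟨ cong₂ (λ s t → s ℚ.* t ℚ.* ℕtoℚ X) εv≡u cq≡a ⟩
      ℕtoℚ u ℚ.* ℕtoℚ a ℚ.* ℕtoℚ X                   ≡⟨ cong (ℚ._* ℕtoℚ X) (sym (ℕtoℚ-homo-* u a)) ⟩
      ℕtoℚ (u * a) ℚ.* ℕtoℚ X                        ≡⟨ sym (ℕtoℚ-homo-* (u * a) X) ⟩
      ℕtoℚ (u * a * X)                               ∎
      where open ≡-Reasoning

    -- Both signs of the absolute value have this shape, with `y` and `x` interchanged. Moving `t`
    -- across and multiplying by `w` leaves a comparison of naturals.
    clear : ∀ s t {i j} → s ℚ.* w ≡ ℕtoℚ i → t ℚ.* w ≡ ℕtoℚ j → i < u * a * X + j → s ℚ.- t ℚ.< z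
    clear s t {i} {j} sw tw i< = subst (s ℚ.- t ℚ.<_)
      (solve 2 (λ z t → z :+ t :- t := z) refl z t) (ℚ.+-monoˡ-< (ℚ.- t) s<z+t)
      where
      s<z+t : s ℚ.< z ℚ.+ t
      s<z+t = ℚ.*-cancelʳ-<-nonNeg w {{ℕtoℚ-nonNeg (q * v)}} (subst₂ ℚ._<_ (sym sw)
        (sym (trans (ℚ.*-distribʳ-+ w z t) (trans (cong₂ ℚ._+_ z*w tw) (sym (ℕtoℚ-homo-+ (u * a * X) j)))))
        (ℕtoℚ-mono-< i<))

  ∣-∣<-from-ℕ : ∣ ℕtoℚ P ℚ.- c ℚ.* ℕtoℚ X ∣ ℚ.< ε ℚ.* (c ℚ.* ℕtoℚ X)
  ∣-∣<-from-ℕ with ℚ.∣p∣≡p∨∣p∣≡-p (y ℚ.- x)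
  ... | inj₁ eq = subst (ℚ._< z) (sym eq) (clear y x y*w x*w up)
  ... | inj₂ eq = subst (ℚ._< z) (sym (trans eq (solve 2 (λ y x → :- (y :- x) := x :- y) refl y x))) (clear x y x*w y*w lo)

-- Assembly of the bounds and choice of the threshold.

-- Makes the truncated subtraction in `constant` exact and the leading coefficient positive.
m<2^[m∸1] : ∀ k → 3 + k < 2 ^ (2 + k)
m<2^[m∸1] zero    = ≤-refl
m<2^[m∸1] (suc k) = begin-strict
  1 + (3 + k)               <⟨ +-monoˡ-< (3 + k) {1} {3 + k} (s≤s (s≤s z≤n)) ⟩
  (3 + k) + (3 + k)         ≤⟨ +-mono-≤ (<⇒≤ (m<2^[m∸1] k)) (<⇒≤ (m<2^[m∸1] k)) ⟩
  2 ^ (2 + k) + 2 ^ (2 + k) ≡⟨ cong (λ z → 2 ^ (2 + k) + z) (sym (+-identityʳ (2 ^ (2 + k)))) ⟩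
  2 ^ (3 + k)               ∎
  where open ≤-Reasoning

module _ (k : ℕ) where

  private
    e = 1 + k
    d = 2 + k
    m = 3 + k
    U = 2 ^ d * d !
    q = 2 ^ m * m !
    a = 2 ^ d ∸ m
    -- `K₁` and `K₂` are the error coefficients of `all-lower` and `long-lower`; `K₃` comes from the
    -- repetition term of `2m*p≤`.
    K₁ = 2 ^ d * (m * d)
    K₂ = suc (2 * d) * d
    K₃ = 2 * m * (m * d)

    a+m≡2^d : a + m ≡ 2 ^ d
    a+m≡2^d = m∸n+n≡m (<⇒≤ (m<2^[m∸1] k))

    -- Splits the order 2m of the dihedral group off `q`, leaving `U`.
    q*≡ : ∀ P → q * P ≡ U * (2 * m * P)
    q*≡ P = solve 4 (λ t f m P → (con 2 :* t) :* (m :* f) :* P := t :* f :* (con 2 :* m :* P)) refl (2 ^ d) (d !) m P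
      where open +-*-Solver

  -- The first two summands serve the upper bound and `K₁` the lower one; their sum serves both.
  errorConstant : ℕ
  errorConstant = m * K₂ + U * K₃ + K₁

  module _ {n₀ : ℕ} (2d≤n₀ : 2 * d ≤ n₀) where

    private
      open Bounds e n₀ 2d≤n₀
      n = suc n₀
      X = n ^ d
      Y = n ^ e
      t = #polygons m n
      b = #compositions m (suc ⌈ n₀ /2⌉)

      U*t+≡ : U * t + m * (U * b) ≡ U * #compositions m n
      U*t+≡ = trans (solve 4 (λ U t m b → U :* t :+ m :* (U :* b) := U :* (t :+ m :* b)) refl U t m b)
        (cong (U *_) (#polygons-formula d n₀ (s≤s (s≤s z≤n)) (≤-trans (s≤s z≤n) 2d≤n₀)))
        where open +-*-Solver

      2^d*X≡ : 2 ^ d * X ≡ a * X + m * X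
      2^d*X≡ = trans (cong (_* X) (sym a+m≡2^d)) (*-distribʳ-+ X a m)

      -- Long tuples enter negatively, so the upper bound for all compositions is paired with the
      -- lower bound for long ones, and `m * (U * b)` is cancelled at the end.
      U*t-upper : U * t ≤ a * X + m * K₂ * Y
      U*t-upper = +-cancelʳ-≤ (m * (U * b)) _ _ (begin
        U * t + m * (U * b)              ≡⟨ U*t+≡ ⟩
        U * #compositions m n            ≤⟨ all-upper ⟩
        2 ^ d * X                        ≡⟨ 2^d*X≡ ⟩
        a * X + m * X                    ≤⟨ +-monoʳ-≤ (a * X) (*-monoʳ-≤ m long-lower) ⟩
        a * X + m * (U * b + K₂ * Y)     ≡⟨ solve 5 (λ aX m Ub K Y → aX :+ m :* (Ub :+ K :* Y) := aX :+ m :* K :* Y :+ m :* Ub) refl (a * X) m (U * b) K₂ Y ⟩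
        a * X + m * K₂ * Y + m * (U * b) ∎)
        where
        open ≤-Reasoning
        open +-*-Solver

      U*t-lower : a * X ≤ U * t + K₁ * Y
      U*t-lower = +-cancelʳ-≤ (m * X) _ _ (begin
        a * X + m * X                    ≡⟨ 2^d*X≡ ⟨
        2 ^ d * X                        ≤⟨ all-lower ⟩
        U * #compositions m n + K₁ * Y   ≡⟨ cong (_+ K₁ * Y) U*t+≡ ⟨
        U * t + m * (U * b) + K₁ * Y     ≤⟨ +-monoˡ-≤ (K₁ * Y) (+-monoʳ-≤ (U * t) (*-monoʳ-≤ m long-upper)) ⟩
        U * t + m * X + K₁ * Y           ≡⟨ solve 3 (λ x y z → x :+ y :+ z := x :+ z :+ y) refl (U * t) (m * X) (K₁ * Y) ⟩
        U * t + K₁ * Y + m * X           ∎)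
        where
        open ≤-Reasoning
        open +-*-Solver

    p-upper : q * p m n ≤ a * X + errorConstant * Y
    p-upper = begin
      q * p m n                                   ≡⟨ q*≡ (p m n) ⟩
      U * (2 * m * p m n)                         ≤⟨ *-monoʳ-≤ U (2m*p≤ m n (s≤s (s≤s (s≤s z≤n)))) ⟩
      U * (t + 2 * m * (m * ∑ (compositions m n) repeatsHead))
        ≤⟨ *-monoʳ-≤ U (+-monoʳ-≤ t (*-monoʳ-≤ (2 * m) (*-monoʳ-≤ m (∑-repeatsHead k n)))) ⟩
      U * (t + 2 * m * (m * (d * Y)))             ≡⟨ solve 5 (λ U t m d Y → U :* (t :+ con 2 :* m :* (m :* (d :* Y))) := U :* t :+ U :* (con 2 :* m :* (m :* d)) :* Y) refl U t m d Y ⟩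
      U * t + U * K₃ * Y                          ≤⟨ +-monoˡ-≤ (U * K₃ * Y) U*t-upper ⟩
      a * X + m * K₂ * Y + U * K₃ * Y             ≤⟨ m≤m+n _ (K₁ * Y) ⟩
      a * X + m * K₂ * Y + U * K₃ * Y + K₁ * Y    ≡⟨ solve 5 (λ x i j l Y → x :+ i :* Y :+ j :* Y :+ l :* Y := x :+ (i :+ j :+ l) :* Y) refl (a * X) (m * K₂) (U * K₃) K₁ Y ⟩
      a * X + errorConstant * Y                   ∎
      where
      open ≤-Reasoning
      open +-*-Solver

    p-lower : a * X ≤ q * p m n + errorConstant * Y
    p-lower = begin
      a * X                         ≤⟨ U*t-lower ⟩
      U * t + K₁ * Y                ≤⟨ +-mono-≤ (*-monoʳ-≤ U (#polygons≤2m*p m n z<s)) (*-monoˡ-≤ Y (m≤n+m K₁ (m * K₂ + U * K₃))) ⟩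
      U * (2 * m * p m n) + errorConstant * Y ≡⟨ cong (_+ errorConstant * Y) (q*≡ (p m n)) ⟨
      q * p m n + errorConstant * Y ∎
      where open ≤-Reasoning

positive-fraction : ∀ ε → 0ℚ ℚ.< ε → ∃ λ u → ∃ λ v → ε ℚ.* ℕtoℚ (suc v) ≡ ℕtoℚ (suc u)
positive-fraction ε 0<ε with ε | ℚ.positive 0<ε
... | r@(mkℚ +[1+ u ] v _) | _ = u , v , trans (cong (ℚ._* ℕtoℚ (suc v)) (sym (ℚ.↥p/↧p≡p r))) (/-*-cancel (suc u) (suc v))

theorem1p8 : (m : ℕ) → m ≥ 3 →
    (ε : ℚ) → 0ℚ ℚ.< ε →
    ∃ λ (N : ℕ) → (n : ℕ) → n ≥ N →
    ∣ ℕtoℚ (p m n) ℚ.- constant m ℚ.* ℕtoℚ (n ^ (m ∸ 1)) ∣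
    ℚ.< ε ℚ.* (constant m ℚ.* ℕtoℚ (n ^ (m ∸ 1)))
theorem1p8 (suc (suc (suc k))) (s≤s (s≤s (s≤s z≤n))) ε 0<ε with positive-fraction ε 0<ε
-- The summand 2d meets the hypothesis of the bounds; the other makes n exceed `suc v * K`, so that
-- one extra factor n beats the error.
... | u , v , εv≡u = suc (2 * d + suc v * K) , bound
  where
  d = 2 + k
  m = 3 + k
  q = 2 ^ m * m !
  a = 2 ^ d ∸ m
  K = errorConstant k

  bound : ∀ n → n ≥ suc (2 * d + suc v * K) →
    ∣ ℕtoℚ (p m n) ℚ.- constant m ℚ.* ℕtoℚ (n ^ d) ∣ ℚ.< ε ℚ.* (constant m ℚ.* ℕtoℚ (n ^ d))
  bound n@(suc n₀) (s≤s N≤n₀) = ∣-∣<-from-ℕ ε (constant m) {a} {q} {suc u} {suc v}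
    (/-*-cancel a q {{m*n≢0 (2 ^ m) (m !) {{m^n≢0 2 m}} {{m !≢0}}}}) εv≡u (p m n) X
    (begin-strict
      p m n * (q * V)              ≡⟨ rearrange ⟩
      q * p m n * V                ≤⟨ *-monoˡ-≤ V (p-upper k 2d≤n₀) ⟩
      (a * X + K * Y) * V          ≡⟨ solve 4 (λ x K Y V → (x :+ K :* Y) :* V := V :* K :* Y :+ x :* V) refl (a * X) K Y V ⟩
      V * K * Y + a * X * V        <⟨ +-monoˡ-< (a * X * V) error< ⟩
      suc u * a * X + a * X * V    ∎)
    (begin-strict
      a * X * V                         ≤⟨ *-monoˡ-≤ V (p-lower k 2d≤n₀) ⟩
      (q * p m n + K * Y) * V           ≡⟨ solve 4 (λ x K Y V → (x :+ K :* Y) :* V := V :* K :* Y :+ x :* V) refl (q * p m n) K Y V ⟩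
      V * K * Y + q * p m n * V         <⟨ +-monoˡ-< (q * p m n * V) error< ⟩
      suc u * a * X + q * p m n * V     ≡⟨ cong (λ z → suc u * a * X + z) rearrange ⟨
      suc u * a * X + p m n * (q * V)   ∎)
    where
    open ≤-Reasoning
    open +-*-Solver
    V = suc v
    X = n ^ d
    Y = n ^ suc k

    2d≤n₀ : 2 * d ≤ n₀
    2d≤n₀ = ≤-trans (m≤m+n (2 * d) _) N≤n₀

    rearrange : p m n * (q * V) ≡ q * p m n * V
    rearrange = solve 3 (λ P q V → P :* (q :* V) := q :* P :* V) refl (p m n) q V

    0<a : 0 < a
    0<a = m<n⇒0<n∸m (m<2^[m∸1] k)

    -- Since n exceeds `V * K`, the left side is below n Y, which is `X`; the numerator `suc u` and
    -- the coefficient `a` are at least 1.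
    error< : V * K * Y < suc u * a * X
    error< = begin-strict
      V * K * Y     <⟨ *-monoˡ-< Y {{m^n≢0 n (suc k)}} (s≤s (≤-trans (m≤n+m (V * K) (2 * d)) N≤n₀)) ⟩
      X             ≡⟨ *-identityˡ X ⟨
      1 * X         ≤⟨ *-monoˡ-≤ X (*-mono-≤ {1} {suc u} (s≤s z≤n) 0<a) ⟩
      suc u * a * X ∎
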